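{- The logics $\mathbf{CL}$, $\mathbf{CLM}$, $\mathbf{IL}$, $\mathbf{ILM}$, $\mathbf{ILP}$ and $\mathbf{ILW}$ are topologically strongly complete: for each such logic $L$, every set $\Gamma$ of $\mathcal{L}(\Box,\rhd)$-formulas and every formula $\varphi$, if $\Gamma\models_L^T\varphi$ then $\Gamma\vdash_L\varphi$.
   Context: The language $\mathcal{L}(\Box,\rhd)$ has countably many propositional variables, $\top,\bot$, $\neg,\land,\lor,\to$, unary $\Box,\Diamond$ ($\Diamond$ dual of $\Box$) and binary $\rhd$. $\mathbf{CL}$ is the smallest set of formulas containing all propositional tautologies, $\Box(p\to q)\to(\Box p\to\Box q)$, $\Box(\Box p\to p)\to\Box p$, J1: $\Box(p\to q)\to(p\rhd q)$; J2: $(p\rhd q)\land(q\rhd r)\to(p\rhd r)$; J3: $(p\rhd r)\land(q\rhd r)\to((p\lor q)\rhd r)$; J4: $(p\rhd q)\to(\Diamond p\to\Diamond q)$, closed under modus ponens, necessitation and substitution. A normal extension of $\mathbf{CL}$ is a superset closed under these rules; $L+\chi$ is the smallest normal extension of $L$ containing $\chi$. Axioms: J5: $\Diamond p\rhd p$; M: $(p\rhd q)\to((p\land\Box r)\rhd(q\land\Box r))$; P: $(p\rhd q)\to\Box(p\rhd q)$; W: $(p\rhd q)\to(p\rhd(q\land\Box\neg p))$. $\mathbf{CLM}=\mathbf{CL}+\mathrm{M}$, $\mathbf{IL}=\mathbf{CL}+\mathrm{J5}$, $\mathbf{ILM}=\mathbf{IL}+\mathrm{M}$, $\mathbf{ILP}=\mathbf{IL}+\mathrm{P}$,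 $\mathbf{ILW}=\mathbf{IL}+\mathrm{W}$. $\Gamma\vdash_L\varphi$ means $\bigwedge\Gamma_0\to\varphi\in L$ for some finite $\Gamma_0\subseteq\Gamma$. For a topology $\tau$ on $X$, $d_\tau(Y)=\{x: \text{every } U\in\tau \text{ containing } x \text{ meets } Y\setminus\{x\}\}$, $cd_\tau(Y)=X\setminus d_\tau(X\setminus Y)$. A bitopological space is $\langle X,\tau^0,\tau^1\rangle$, $X\ne\varnothing$, $\tau^0,\tau^1$ topologies. $e_{\tau^0,\tau^1}(Y,Z)=\{x:\forall U\in\tau^1[x\in d_{\tau^0}(Y\cap U)\Rightarrow x\in d_{\tau^0}(Z\cap U)]\}$. A valuation $v$ maps formulas to subsets of $X$, Boolean on connectives, with $v(\Box\varphi)=cd_{\tau^0}(v(\varphi))$, $v(\Diamond\varphi)=d_{\tau^0}(v(\varphi))$, $v(\varphi\rhd\psi)=e_{\tau^0,\tau^1}(v(\varphi),v(\psi))$. $\mathrm{Log}(X,\tau^0,\tau^1)$ is the set of formulas $\varphi$ with $v(\varphi)=X$ for all $v$; an $L$-space satisfies $L\subseteq\mathrm{Log}(X,\tau^0,\tau^1)$. $\Gamma\models_L^T\varphi$ means: in every $L$-space, for every valuation $v$ and point $x$, if $x\in v(\psi)$ for all $\psi\in\Gamma$ then $x\in v(\varphi)$. -}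

module Defs where

open import Level using (Level; 0ℓ; Setω)
open import Data.Nat using (ℕ)
open import Data.Bool using (Bool; true; false; not; _∧_; _∨_)
open import Data.Product using (Σ; _×_; _,_; ∃)
open import Data.Sum using (_⊎_)
open import Data.Unit using (⊤)
open import Data.Empty using (⊥)
open import Data.List using (List; []; _∷_)
open import Data.List.Relation.Unary.All using (All)
open import Relation.Nullary using (¬_)
open import Relation.Binary.PropositionalEquality using (_≡_)
open import Function.Bundles using (_⇔_)
open import Axiom.ExcludedMiddle using (ExcludedMiddle)

infixr 6 _∧'_
infixr 5 _∨'_
infixr 4 _⇒_
infix 7 _▷_

data Fm : Set where
  var  : ℕ → Fm
  ⊤'   : Fm
  ⊥'   : Fm
  ¬'_  : Fm → Fm
  _∧'_ : Fm → Fm → Fm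
  _∨'_ : Fm → Fm → Fm
  _⇒_  : Fm → Fm → Fm
  □_   : Fm → Fm
  _▷_  : Fm → Fm → Fm

◇_ : Fm → Fm
◇ φ = ¬' (□ (¬' φ))

sub : (ℕ → Fm) → Fm → Fm
sub σ (var n)  = σ n
sub σ ⊤'       = ⊤'
sub σ ⊥'       = ⊥'
sub σ (¬' φ)   = ¬' (sub σ φ)
sub σ (φ ∧' ψ) = sub σ φ ∧' sub σ ψ
sub σ (φ ∨' ψ) = sub σ φ ∨' sub σ ψ
sub σ (φ ⇒ ψ)  = sub σ φ ⇒ sub σ ψ
sub σ (□ φ)    = □ (sub σ φ)
sub σ (φ ▷ ψ)  = sub σ φ ▷ sub σ ψ

-- Propositional tautologies (modality-free formulas true under every
-- Boolean assignment); closure under substitution yields all instances.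

data Propositional : Fm → Set where
  pvar : ∀ n → Propositional (var n)
  ptop : Propositional ⊤'
  pbot : Propositional ⊥'
  pneg : ∀ {φ} → Propositional φ → Propositional (¬' φ)
  pand : ∀ {φ ψ} → Propositional φ → Propositional ψ → Propositional (φ ∧' ψ)
  por  : ∀ {φ ψ} → Propositional φ → Propositional ψ → Propositional (φ ∨' ψ)
  pimp : ∀ {φ ψ} → Propositional φ → Propositional ψ → Propositional (φ ⇒ ψ)

-- Boolean evaluation (modal subformulas are irrelevant for
-- propositional formulas; they are given value false here)
bev : (ℕ → Bool) → Fm → Bool
bev a (var n)  = a n
bev a ⊤'       = true
bev a ⊥'       = false
bev a (¬' φ)   = not (bev a φ)
bev a (φ ∧' ψ) = bev a φ ∧ bev a ψ
bev a (φ ∨' ψ) = bev a φ ∨ bev a ψ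
bev a (φ ⇒ ψ)  = not (bev a φ) ∨ bev a ψ
bev a (□ φ)    = false
bev a (φ ▷ ψ)  = false

Tautology : Fm → Set
Tautology φ = Propositional φ × ((a : ℕ → Bool) → bev a φ ≡ true)

p q r : Fm
p = var 0
q = var 1
r = var 2

axK axL axJ1 axJ2 axJ3 axJ4 axJ5 axM axP axW : Fm
axK  = □ (p ⇒ q) ⇒ (□ p ⇒ □ q)
axL  = □ (□ p ⇒ p) ⇒ □ p
axJ1 = □ (p ⇒ q) ⇒ (p ▷ q)
axJ2 = ((p ▷ q) ∧' (q ▷ r)) ⇒ (p ▷ r)
axJ3 = ((p ▷ r) ∧' (q ▷ r)) ⇒ ((p ∨' q) ▷ r)
axJ4 = (p ▷ q) ⇒ (◇ p ⇒ ◇ q)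
axJ5 = (◇ p) ▷ p
axM  = (p ▷ q) ⇒ ((p ∧' □ r) ▷ (q ∧' □ r))
axP  = (p ▷ q) ⇒ □ (p ▷ q)
axW  = (p ▷ q) ⇒ (p ▷ (q ∧' □ (¬' p)))

data Logic : Set where
  CL CLM IL ILM ILP ILW : Logic

Extra : Logic → Fm → Set
Extra CL  φ = ⊥
Extra CLM φ = φ ≡ axM
Extra IL  φ = φ ≡ axJ5
Extra ILM φ = (φ ≡ axJ5) ⊎ (φ ≡ axM)
Extra ILP φ = (φ ≡ axJ5) ⊎ (φ ≡ axP)
Extra ILW φ = (φ ≡ axJ5) ⊎ (φ ≡ axW)

data Thm (L : Logic) : Fm → Set where
  taut  : ∀ {φ} → Tautology φ → Thm L φ
  ak    : Thm L axK
  al    : Thm L axL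
  aj1   : Thm L axJ1
  aj2   : Thm L axJ2
  aj3   : Thm L axJ3
  aj4   : Thm L axJ4
  extra : ∀ {φ} → Extra L φ → Thm L φ
  mp    : ∀ {φ ψ} → Thm L (φ ⇒ ψ) → Thm L φ → Thm L ψ
  nec   : ∀ {φ} → Thm L φ → Thm L (□ φ)
  subst : ∀ {φ} (σ : ℕ → Fm) → Thm L φ → Thm L (sub σ φ)

⋀ : List Fm → Fm
⋀ []       = ⊤'
⋀ (φ ∷ φs) = φ ∧' ⋀ φs

_⊢[_]_ : (Fm → Set) → Logic → Fm → Set
Γ ⊢[ L ] φ = Σ (List Fm) λ Γ₀ → All Γ Γ₀ × Thm L (⋀ Γ₀ ⇒ φ)

-- Topologies. Subsets of X that are opens are given as characteristic
-- functions X → Bool; arbitrary subsets (valuations) as X → Set.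

record Topology (X : Set) : Set₁ where
  field
    isOpen : (X → Bool) → Set
    resp   : ∀ U V → (∀ x → U x ≡ V x) → isOpen U → isOpen V
    empty  : isOpen (λ _ → false)
    full   : isOpen (λ _ → true)
    inter  : ∀ U V → isOpen U → isOpen V → isOpen (λ x → U x ∧ V x)
    union  : (𝒰 : (X → Bool) → Set) → (∀ U → 𝒰 U → isOpen U) →
             (W : X → Bool) →
             (∀ x → (W x ≡ true) ⇔ Σ (X → Bool) (λ U → 𝒰 U × (U x ≡ true))) →
             isOpen W
open Topology public

d : {X : Set} → Topology X → (X → Set) → X → Set
d {X} τ Y x = ∀ U → isOpen τ U → U x ≡ true →
              Σ X λ y → Y y × ¬ (y ≡ x) × (U y ≡ true)

cd : {X : Set} → Topology X → (X → Set) → X → Set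
cd τ Y x = ¬ d τ (λ y → ¬ Y y) x

e : {X : Set} → Topology X → Topology X → (X → Set) → (X → Set) → X → Set
e {X} τ0 τ1 Y Z x = ∀ U → isOpen τ1 U →
  d τ0 (λ y → Y y × (U y ≡ true)) x → d τ0 (λ y → Z y × (U y ≡ true)) x

⟦_⟧ : {X : Set} → Fm → Topology X → Topology X → (ℕ → X → Set) → X → Set
⟦ var n  ⟧ τ0 τ1 V x = V n x
⟦ ⊤'     ⟧ τ0 τ1 V x = ⊤
⟦ ⊥'     ⟧ τ0 τ1 V x = ⊥
⟦ ¬' φ   ⟧ τ0 τ1 V x = ¬ ⟦ φ ⟧ τ0 τ1 V x
⟦ φ ∧' ψ ⟧ τ0 τ1 V x = ⟦ φ ⟧ τ0 τ1 V x × ⟦ ψ ⟧ τ0 τ1 V x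
⟦ φ ∨' ψ ⟧ τ0 τ1 V x = ⟦ φ ⟧ τ0 τ1 V x ⊎ ⟦ ψ ⟧ τ0 τ1 V x
⟦ φ ⇒ ψ  ⟧ τ0 τ1 V x = ⟦ φ ⟧ τ0 τ1 V x → ⟦ ψ ⟧ τ0 τ1 V x
⟦ □ φ    ⟧ τ0 τ1 V x = cd τ0 (⟦ φ ⟧ τ0 τ1 V) x
⟦ φ ▷ ψ  ⟧ τ0 τ1 V x = e τ0 τ1 (⟦ φ ⟧ τ0 τ1 V) (⟦ ψ ⟧ τ0 τ1 V) x

record BiSpace : Set₁ where
  field
    X   : Set
    pt  : X
    τ0  : Topology X
    τ1  : Topology X
open BiSpace public

IsLSpace : Logic → BiSpace → Set₁
IsLSpace L S = ∀ φ → Thm L φ → (V : ℕ → X S → Set) → (x : X S) →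
               ⟦ φ ⟧ (τ0 S) (τ1 S) V x

_⊨[_]_ : (Fm → Set) → Logic → Fm → Set₁
Γ ⊨[ L ] φ = (S : BiSpace) → IsLSpace L S → (V : ℕ → X S → Set) → (x : X S) →
             (∀ ψ → Γ ψ → ⟦ ψ ⟧ (τ0 S) (τ1 S) V x) → ⟦ φ ⟧ (τ0 S) (τ1 S) V x

Classical : Setω
Classical = ∀ {ℓ : Level} → ExcludedMiddle ℓ

{-# OPTIONS --safe #-}
module Submission where

-- Extend Γ ∪ {¬ φ} to a maximal consistent set Δ.  For each finite set Φ of formulas there is a frame
-- with a transitive, conversely well-founded relation R (inducing τ0) and one relation S (inducing
-- τ1), at whose root the members of Φ are true exactly if they belong to Δ.  Joining all
-- these frames below one new point, whose neighbourhoods contain the frames of all large enough Φ,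
-- gives a space with Δ true at that point; it validates L because its axioms are Horn clauses in
-- modal formulas and so survive the reduced product.
--
-- Converse well-foundedness comes from replacing a set Γ by Γ °, which has the same members in Φ but
-- no proper successor with exactly these members (Löb's axiom).  Successors are always chosen with
-- respect to Γ °, so that each R-step excludes a further one of the finitely many types over Φ.
--
-- For CL, IL, ILP and ILW the frame of Γ ° is glued from the frames of its successors.  Axiom M
-- forces a point to see the R-successors of its S-successors, so for CLM and ILM the frame is
-- instead generated freely, its points being their own creation histories.

open import Data.Nat using (ℕ; zero; suc; _+_; _≤_; _<_; s≤s; z≤n)
open import Data.Nat.Properties
  using (≤-refl; ≤-trans; <-trans; <-irrefl; ≤-<-trans; <⇒≤; m≤n⇒m≤1+n; m≤m+n; m≤n+m; n<1+n;
         +-comm; +-suc; ≤-reflexive; suc-injective; m≤n⇒m<n∨m≡n)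
open import Data.Nat.Induction using (<-wellFounded)
open import Data.Bool using (Bool; true; false; _∧_)
open import Data.Maybe using (Maybe; just; nothing)
open import Data.Product using (Σ; _×_; _,_; proj₁; proj₂)
open import Data.Sum using (_⊎_; inj₁; inj₂; [_,_]′; swap)
open import Data.Unit using (⊤; tt)
open import Data.Empty using (⊥; ⊥-elim)
open import Data.List using (List; []; _∷_; _++_; map; length; cartesianProductWith; filter)
open import Data.List.Relation.Unary.All using ([]; _∷_)
open import Data.List.Relation.Unary.All.Properties using (++⁺)
open import Data.List.Relation.Unary.Any using (here; there)
open import Data.List.Membership.Propositional using (_∈_)
open import Data.List.Membership.Propositional.Properties
  using (∈-++⁺ˡ; ∈-++⁺ʳ; ∈-++⁻; ∈-map⁺; ∈-cartesianProductWith⁺; ∈-∃++; ∈-filter⁺; ∈-filter⁻)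
open import Relation.Nullary using (¬_; Dec; yes; no)
open import Relation.Binary.PropositionalEquality
  using (_≡_; refl; sym; trans; cong; cong₂) renaming (subst to transport)
open import Function.Bundles using (module Equivalence)
open import Induction.WellFounded using (WellFounded; Acc; acc; module Subrelation)
import Relation.Binary.Construct.On as On

open import Defs

-- The extra point is forced by Löb's axiom, which destroys compactness for relational frames:
-- `◇ p₀` together with all `□ (pᵢ ⇒ ◇ pᵢ₊₁)` is consistent, yet a point of a transitive, conversely
-- well-founded frame satisfying all of it would start an infinite `R`-chain. A neighbourhood filter
-- lets each formula become true from some finite `Φ` on. The other obstacle is that τ1 is one
-- topology for the whole space, so there is a single `S`, where Veltman semantics has one relation
-- for each point. An S-step that serves `B ▷ C` at one point is visible from all others: it must
-- not make their false `▷`-formulas true, nor break the conditions for the axioms. Hence the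
-- control over directions, levels and creation histories in the two constructions.

-- Exhausting the language by finite lists

rank : Fm → ℕ
rank (var n)  = n
rank ⊤'       = 0
rank ⊥'       = 0
rank (¬' A)   = suc (rank A)
rank (A ∧' B) = suc (rank A + rank B)
rank (A ∨' B) = suc (rank A + rank B)
rank (A ⇒ B)  = suc (rank A + rank B)
rank (□ A)    = suc (rank A)
rank (A ▷ B)  = suc (rank A + rank B)

binary : List Fm → List Fm
binary l = cartesianProductWith _∧'_ l l ++ cartesianProductWith _∨'_ l l
           ++ cartesianProductWith _⇒_ l l ++ cartesianProductWith _▷_ l l

-- A variable counts with its index as rank, so only finitely many formulas have rank below `n`.
-- These lists stand in for an enumeration of all formulas.
formulas : ℕ → List Fm
formulas zero    = []
formulas (suc n) = var n ∷ ⊤' ∷ ⊥' ∷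
  (formulas n ++ map ¬'_ (formulas n) ++ map □_ (formulas n) ++ binary (formulas n))

module _ {A B : Fm} {l : List Fm} (a : A ∈ l) (b : B ∈ l) where

  ∈-binary-∧ : A ∧' B ∈ binary l
  ∈-binary-∧ = ∈-++⁺ˡ (∈-cartesianProductWith⁺ _∧'_ a b)

  ∈-binary-∨ : A ∨' B ∈ binary l
  ∈-binary-∨ = ∈-++⁺ʳ (cartesianProductWith _∧'_ l l) (∈-++⁺ˡ (∈-cartesianProductWith⁺ _∨'_ a b))

  ∈-binary-⇒ : (A ⇒ B) ∈ binary l
  ∈-binary-⇒ = ∈-++⁺ʳ (cartesianProductWith _∧'_ l l) (∈-++⁺ʳ (cartesianProductWith _∨'_ l l)
    (∈-++⁺ˡ (∈-cartesianProductWith⁺ _⇒_ a b)))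

  ∈-binary-▷ : A ▷ B ∈ binary l
  ∈-binary-▷ = ∈-++⁺ʳ (cartesianProductWith _∧'_ l l) (∈-++⁺ʳ (cartesianProductWith _∨'_ l l)
    (∈-++⁺ʳ (cartesianProductWith _⇒_ l l) (∈-cartesianProductWith⁺ _▷_ a b)))

∈-formulas-keep : ∀ {A} n → A ∈ formulas n → A ∈ formulas (suc n)
∈-formulas-keep n a = there (there (there (∈-++⁺ˡ a)))

∈-formulas-binary : ∀ {A} n → A ∈ binary (formulas n) → A ∈ formulas (suc n)
∈-formulas-binary n a = there (there (there (∈-++⁺ʳ (formulas n)
  (∈-++⁺ʳ (map ¬'_ (formulas n)) (∈-++⁺ʳ (map □_ (formulas n)) a)))))

≤-split : ∀ {m n} → m < suc n → (m ≡ n) ⊎ (m < n)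
≤-split {zero}  {zero}  _           = inj₁ refl
≤-split {zero}  {suc n} _           = inj₂ (s≤s z≤n)
≤-split {suc m} {zero}  (s≤s ())
≤-split {suc m} {suc n} (s≤s m<1+n) with ≤-split m<1+n
... | inj₁ eq = inj₁ (cong suc eq)
... | inj₂ lt = inj₂ (s≤s lt)

m+n<o⇒m<o : ∀ {m o} n → m + n < o → m < o
m+n<o⇒m<o {m} n = ≤-<-trans (m≤m+n m n)

m+n<o⇒n<o : ∀ {n o} m → m + n < o → n < o
m+n<o⇒n<o {n} m = ≤-<-trans (m≤n+m n m)

∈-formulas : ∀ A n → rank A < n → A ∈ formulas n
∈-formulas (var i) (suc n) lt with ≤-split lt
... | inj₁ refl = here refl
... | inj₂ i<n  = ∈-formulas-keep n (∈-formulas (var i) n i<n)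
∈-formulas ⊤' (suc n) _ = there (here refl)
∈-formulas ⊥' (suc n) _ = there (there (here refl))
∈-formulas (¬' A) (suc n) (s≤s lt) = there (there (there (∈-++⁺ʳ (formulas n)
  (∈-++⁺ˡ (∈-map⁺ ¬'_ (∈-formulas A n lt))))))
∈-formulas (A ∧' B) (suc n) (s≤s lt) = ∈-formulas-binary n
  (∈-binary-∧ (∈-formulas A n (m+n<o⇒m<o (rank B) lt)) (∈-formulas B n (m+n<o⇒n<o (rank A) lt)))
∈-formulas (A ∨' B) (suc n) (s≤s lt) = ∈-formulas-binary n
  (∈-binary-∨ (∈-formulas A n (m+n<o⇒m<o (rank B) lt)) (∈-formulas B n (m+n<o⇒n<o (rank A) lt)))
∈-formulas (A ⇒ B) (suc n) (s≤s lt) = ∈-formulas-binary n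
  (∈-binary-⇒ (∈-formulas A n (m+n<o⇒m<o (rank B) lt)) (∈-formulas B n (m+n<o⇒n<o (rank A) lt)))
∈-formulas (□ A) (suc n) (s≤s lt) = there (there (there (∈-++⁺ʳ (formulas n)
  (∈-++⁺ʳ (map ¬'_ (formulas n)) (∈-++⁺ˡ (∈-map⁺ □_ (∈-formulas A n lt)))))))
∈-formulas (A ▷ B) (suc n) (s≤s lt) = ∈-formulas-binary n
  (∈-binary-▷ (∈-formulas A n (m+n<o⇒m<o (rank B) lt)) (∈-formulas B n (m+n<o⇒n<o (rank A) lt)))

-- The axioms of the six logics

HasJ5 HasM HasP HasW : Logic → Set
HasJ5 CL  = ⊥
HasJ5 CLM = ⊥
HasJ5 _   = ⊤
HasM CLM = ⊤
HasM ILM = ⊤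
HasM _   = ⊥
HasP ILP = ⊤
HasP _   = ⊥
HasW ILW = ⊤
HasW _   = ⊥

Schema : Logic → Fm → Set
Schema L φ = (HasJ5 L × φ ≡ axJ5) ⊎ (HasM L × φ ≡ axM) ⊎ (HasP L × φ ≡ axP) ⊎ (HasW L × φ ≡ axW)

extra-schema : ∀ L {φ} → Extra L φ → Schema L φ
extra-schema CLM eq        = inj₂ (inj₁ (tt , eq))
extra-schema IL  eq        = inj₁ (tt , eq)
extra-schema ILM (inj₁ eq) = inj₁ (tt , eq)
extra-schema ILM (inj₂ eq) = inj₂ (inj₁ (tt , eq))
extra-schema ILP (inj₁ eq) = inj₁ (tt , eq)
extra-schema ILP (inj₂ eq) = inj₂ (inj₂ (inj₁ (tt , eq)))
extra-schema ILW (inj₁ eq) = inj₁ (tt , eq)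
extra-schema ILW (inj₂ eq) = inj₂ (inj₂ (inj₂ (tt , eq)))

HasW⇒HasJ5 : ∀ L → HasW L → HasJ5 L
HasW⇒HasJ5 ILW h = tt

σ₃ : Fm → Fm → Fm → ℕ → Fm
σ₃ A B C 0 = A
σ₃ A B C 1 = B
σ₃ A B C _ = C

-- Propositional theorems

module Tautologies {L : Logic} where

  private
    P = pvar 0
    Q = pvar 1
    R = pvar 2

  weaken : ∀ A B → Thm L (A ⇒ (B ⇒ A))
  weaken A B = subst (σ₃ A B B) (taut (pimp P (pimp Q P) , v))
    where v : ∀ a → bev a (p ⇒ (q ⇒ p)) ≡ true
          v a with a 0 | a 1
          ... | true  | true  = refl
          ... | true  | false = refl
          ... | false | _     = refl

  distribute : ∀ A B C → Thm L ((A ⇒ (B ⇒ C)) ⇒ ((A ⇒ B) ⇒ (A ⇒ C)))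
  distribute A B C = subst (σ₃ A B C)
    (taut (pimp (pimp P (pimp Q R)) (pimp (pimp P Q) (pimp P R)) , v))
    where v : ∀ a → bev a ((p ⇒ (q ⇒ r)) ⇒ ((p ⇒ q) ⇒ (p ⇒ r))) ≡ true
          v a with a 0 | a 1 | a 2
          ... | true  | true  | true  = refl
          ... | true  | true  | false = refl
          ... | true  | false | _     = refl
          ... | false | _     | _     = refl

  cases : ∀ A C → Thm L ((A ⇒ C) ⇒ ((¬' A ⇒ C) ⇒ C))
  cases A C = subst (σ₃ A C C) (taut (pimp (pimp P Q) (pimp (pimp (pneg P) Q) Q) , v))
    where v : ∀ a → bev a ((p ⇒ q) ⇒ ((¬' p ⇒ q) ⇒ q)) ≡ true
          v a with a 0 | a 1
          ... | true  | true  = refl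
          ... | true  | false = refl
          ... | false | true  = refl
          ... | false | false = refl

  explosion : ∀ A B → Thm L (¬' A ⇒ (A ⇒ B))
  explosion A B = subst (σ₃ A B B) (taut (pimp (pneg P) (pimp P Q) , v))
    where v : ∀ a → bev a (¬' p ⇒ (p ⇒ q)) ≡ true
          v a with a 0
          ... | true  = refl
          ... | false = refl

  ⊥-explosion : ∀ A → Thm L (⊥' ⇒ A)
  ⊥-explosion A = subst (σ₃ A A A) (taut (pimp pbot P , λ _ → refl))

  ⊤-intro : Thm L ⊤'
  ⊤-intro = taut (ptop , λ _ → refl)

  ∧-elimˡ : ∀ A B → Thm L (A ∧' B ⇒ A)
  ∧-elimˡ A B = subst (σ₃ A B B) (taut (pimp (pand P Q) P , v))
    where v : ∀ a → bev a (p ∧' q ⇒ p) ≡ true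
          v a with a 0 | a 1
          ... | true  | true  = refl
          ... | true  | false = refl
          ... | false | _     = refl

  ∧-elimʳ : ∀ A B → Thm L (A ∧' B ⇒ B)
  ∧-elimʳ A B = subst (σ₃ A B B) (taut (pimp (pand P Q) Q , v))
    where v : ∀ a → bev a (p ∧' q ⇒ q) ≡ true
          v a with a 0 | a 1
          ... | true  | true  = refl
          ... | true  | false = refl
          ... | false | _     = refl

  ∧-intro : ∀ A B → Thm L (A ⇒ (B ⇒ A ∧' B))
  ∧-intro A B = subst (σ₃ A B B) (taut (pimp P (pimp Q (pand P Q)) , v))
    where v : ∀ a → bev a (p ⇒ (q ⇒ p ∧' q)) ≡ true
          v a with a 0 | a 1
          ... | true  | true  = refl
          ... | true  | false = refl
          ... | false | _     = refl

  ∨-introˡ : ∀ A B → Thm L (A ⇒ A ∨' B)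
  ∨-introˡ A B = subst (σ₃ A B B) (taut (pimp P (por P Q) , v))
    where v : ∀ a → bev a (p ⇒ p ∨' q) ≡ true
          v a with a 0
          ... | true  = refl
          ... | false = refl

  ∨-introʳ : ∀ A B → Thm L (B ⇒ A ∨' B)
  ∨-introʳ A B = subst (σ₃ A B B) (taut (pimp Q (por P Q) , v))
    where v : ∀ a → bev a (q ⇒ p ∨' q) ≡ true
          v a with a 0 | a 1
          ... | true  | true  = refl
          ... | true  | false = refl
          ... | false | true  = refl
          ... | false | false = refl

  ∨-elim : ∀ A B → Thm L (A ∨' B ⇒ (¬' A ⇒ B))
  ∨-elim A B = subst (σ₃ A B B) (taut (pimp (por P Q) (pimp (pneg P) Q) , v))
    where v : ∀ a → bev a (p ∨' q ⇒ (¬' p ⇒ q)) ≡ true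
          v a with a 0 | a 1
          ... | true  | true  = refl
          ... | true  | false = refl
          ... | false | true  = refl
          ... | false | false = refl

module Completeness (em : Classical) (L : Logic) where

  open Tautologies {L}

  ¬¬-elim : ∀ {ℓ} {A : Set ℓ} → ¬ ¬ A → A
  ¬¬-elim {A = A} ¬¬a with em {P = A}
  ... | yes a = a
  ... | no ¬a = ⊥-elim (¬¬a ¬a)

  χ : Set → Bool
  χ A with em {P = A}
  ... | yes _ = true
  ... | no  _ = false

  χ⁺ : ∀ {A} → A → χ A ≡ true
  χ⁺ {A} a with em {P = A}
  ... | yes _ = refl
  ... | no ¬a = ⊥-elim (¬a a)

  χ⁻ : ∀ {A} → χ A ≡ true → A
  χ⁻ {A} eq with em {P = A}
  χ⁻ {A} eq | yes a = a
  χ⁻ {A} () | no _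

  -- Maximal consistent theories

  record Theory : Set₁ where
    field
      has  : Fm → Set
      thms : ∀ {A} → Thm L A → has A
      app  : ∀ {A B} → has (A ⇒ B) → has A → has B

  -- Unlike in a `Theory`, membership is Boolean, which keeps `MCS` in `Set`: labels occur inside
  -- points, and the points of a `BiSpace` form a `Set`.
  record MCS : Set where
    field
      mem  : Fm → Bool
      thms : ∀ {A} → Thm L A → mem A ≡ true
      app  : ∀ {A B} → mem (A ⇒ B) ≡ true → mem A ≡ true → mem B ≡ true
      cons : ¬ mem ⊥' ≡ true
      full : ∀ A → ¬ mem A ≡ true → mem (¬' A) ≡ true

  infix 3 _∋_ _∌_

  record _∋_ (Γ : MCS) (A : Fm) : Set where
    constructor holds
    field holds⁻ : MCS.mem Γ A ≡ true
  open _∋_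

  _∌_ : MCS → Fm → Set
  Γ ∌ A = ¬ (Γ ∋ A)

  -- Lindenbaum's lemma

  module Lindenbaum (φ : Fm) where

    open Theory

    record Avoiding : Set₁ where
      field
        theory : Theory
        avoids : ¬ has theory φ
    open Avoiding

    infix 3 _⊢_ _⊆_
    _⊢_ : Avoiding → Fm → Set
    𝒯 ⊢ A = has (theory 𝒯) A

    _⊆_ : Avoiding → Avoiding → Set
    𝒯 ⊆ 𝒰 = ∀ {A} → 𝒯 ⊢ A → 𝒰 ⊢ A

    Decides : Avoiding → Fm → Set
    Decides 𝒯 A = (𝒯 ⊢ A) ⊎ (𝒯 ⊢ A ⇒ φ)

    -- Adding `A` is defined through implications from `A`, so the deduction theorem is built in.
    extend : (𝒯 : Avoiding) (A : Fm) → ¬ (𝒯 ⊢ A ⇒ φ) → Avoiding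
    extend 𝒯 A ¬Aφ = record
      { theory = record
          { has  = λ B → 𝒯 ⊢ A ⇒ B
          ; thms = λ t → app (theory 𝒯) (thms (theory 𝒯) (weaken _ A)) (thms (theory 𝒯) t)
          ; app  = λ f a → app (theory 𝒯) (app (theory 𝒯) (thms (theory 𝒯) (distribute A _ _)) f) a }
      ; avoids = ¬Aφ }

    step : ∀ 𝒯 A → Σ Avoiding λ 𝒰 → (𝒯 ⊆ 𝒰) × Decides 𝒰 A
    step 𝒯 A with em {P = 𝒯 ⊢ A ⇒ φ}
    ... | yes Aφ = 𝒯 , (λ t → t) , inj₂ Aφ
    ... | no ¬Aφ = extend 𝒯 A ¬Aφ
                 , (λ t → app (theory 𝒯) (thms (theory 𝒯) (weaken _ A)) t)
                 , inj₁ (app (theory 𝒯) (app (theory 𝒯) (thms (theory 𝒯) (distribute A (A ⇒ A) A))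
                     (thms (theory 𝒯) (weaken A (A ⇒ A)))) (thms (theory 𝒯) (weaken A A)))

    Decides-mono : ∀ {𝒯 𝒰 A} → 𝒯 ⊆ 𝒰 → Decides 𝒯 A → Decides 𝒰 A
    Decides-mono s (inj₁ a) = inj₁ (s a)
    Decides-mono s (inj₂ a) = inj₂ (s a)

    steps : ∀ 𝒯 (l : List Fm) → Σ Avoiding λ 𝒰 → (𝒯 ⊆ 𝒰) × (∀ {A} → A ∈ l → Decides 𝒰 A)
    steps 𝒯 [] = 𝒯 , (λ t → t) , λ ()
    steps 𝒯 (A ∷ l) =
      let 𝒰 , s , dA = step 𝒯 A
          𝒱 , t , dl = steps 𝒰 l
      in 𝒱 , (λ x → t (s x)) , λ { (here refl) → Decides-mono {𝒰} {𝒱} t dA ; (there m) → dl m }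

    module _ (𝒯₀ : Avoiding) where

      stage : ℕ → Avoiding
      stage zero    = 𝒯₀
      stage (suc n) = proj₁ (steps (stage n) (formulas n))

      stage-suc : ∀ n → stage n ⊆ stage (suc n)
      stage-suc n = proj₁ (proj₂ (steps (stage n) (formulas n)))

      stage-mono : ∀ m n → stage n ⊆ stage (m + n)
      stage-mono zero    n t = t
      stage-mono (suc m) n t = stage-suc (m + n) (stage-mono m n t)

      stage-mono′ : ∀ m n → stage m ⊆ stage (m + n)
      stage-mono′ m n {A} t = transport (λ k → stage k ⊢ A) (+-comm n m) (stage-mono n m t)

      limit : Fm → Set
      limit A = Σ ℕ λ n → stage n ⊢ A

      limit-app : ∀ {A B} → limit (A ⇒ B) → limit A → limit B
      limit-app (m , f) (n , a) =
        m + n , app (theory (stage (m + n))) (stage-mono′ m n f) (stage-mono m n a)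

      limit-thms : ∀ {A} → Thm L A → limit A
      limit-thms t = 0 , thms (theory 𝒯₀) t

      limit-avoids : ¬ limit φ
      limit-avoids (n , t) = avoids (stage n) t

      limit-decides : ∀ A → limit A ⊎ limit (A ⇒ φ)
      limit-decides A with proj₂ (proj₂ (steps (stage (suc (rank A))) (formulas (suc (rank A)))))
                           (∈-formulas A (suc (rank A)) (n<1+n (rank A)))
      ... | inj₁ a = inj₁ (suc (suc (rank A)) , a)
      ... | inj₂ a = inj₂ (suc (suc (rank A)) , a)

      -- Avoiding `φ` is enough for maximality: with both `A ⇒ φ` and `¬' A ⇒ φ` the limit would
      -- contain `φ`.
      limit-full : ∀ A → ¬ limit A → limit (¬' A)
      limit-full A ¬a with limit-decides A | limit-decides (¬' A)
      ... | inj₁ a  | _       = ⊥-elim (¬a a)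
      ... | inj₂ _  | inj₁ na = na
      ... | inj₂ aφ | inj₂ nφ =
        ⊥-elim (limit-avoids (limit-app (limit-app (limit-thms (cases A φ)) aφ) nφ))

      limit-MCS : MCS
      limit-MCS = record
        { mem  = λ A → χ (limit A)
        ; thms = λ t → χ⁺ (limit-thms t)
        ; app  = λ f a → χ⁺ (limit-app (χ⁻ f) (χ⁻ a))
        ; cons = λ b → limit-avoids (limit-app (limit-thms (⊥-explosion φ)) (χ⁻ b))
        ; full = λ A na → χ⁺ (limit-full A (λ a → na (χ⁺ a))) }

  abstract
    lindenbaum : (𝒯 : Theory) (φ : Fm) → ¬ Theory.has 𝒯 φ →
                 Σ MCS λ Δ → (∀ {A} → Theory.has 𝒯 A → Δ ∋ A) × (Δ ∌ φ)
    lindenbaum 𝒯 φ nφ = limit-MCS 𝒯₀ , (λ t → holds (χ⁺ (0 , t))) , λ t → limit-avoids 𝒯₀ (χ⁻ (holds⁻ t))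
      where open Lindenbaum φ
            𝒯₀ : Avoiding
            𝒯₀ = record { theory = 𝒯 ; avoids = nφ }

  -- Through this, later derivations inside `L` become pointwise arguments about members of a
  -- maximal consistent set.
  valid⇒Thm : ∀ {A} → (∀ Δ → Δ ∋ A) → Thm L A
  valid⇒Thm {A} v = ¬¬-elim λ nt →
    let Δ , _ , na = lindenbaum (record { has = Thm L ; thms = λ t → t ; app = mp }) A nt
    in na (v Δ)

  module _ {Γ : MCS} where

    ∋-thm : ∀ {A} → Thm L A → Γ ∋ A
    ∋-thm t = holds (MCS.thms Γ t)

    ∋-app : ∀ {A B} → Γ ∋ A ⇒ B → Γ ∋ A → Γ ∋ B
    ∋-app f a = holds (MCS.app Γ (holds⁻ f) (holds⁻ a))

    ∋-⊥ : Γ ∌ ⊥'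
    ∋-⊥ b = MCS.cons Γ (holds⁻ b)

    ∋-mp : ∀ {A B} → Thm L (A ⇒ B) → Γ ∋ A → Γ ∋ B
    ∋-mp t = ∋-app (∋-thm t)

    ∋-¬⁻ : ∀ {A} → Γ ∋ ¬' A → Γ ∌ A
    ∋-¬⁻ na a = ∋-⊥ (∋-app (∋-mp (explosion _ ⊥') na) a)

    ∋-¬⁺ : ∀ {A} → Γ ∌ A → Γ ∋ ¬' A
    ∋-¬⁺ {A} na = holds (MCS.full Γ A λ a → na (holds a))

    ∋-¬¬ : ∀ {A} → Γ ∌ ¬' A → Γ ∋ A
    ∋-¬¬ nn = ¬¬-elim λ na → nn (∋-¬⁺ na)

    ∋-⇒⁺ : ∀ {A B} → (Γ ∋ A → Γ ∋ B) → Γ ∋ A ⇒ B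
    ∋-⇒⁺ {A} {B} f with em {P = Γ ∋ A}
    ... | yes a = ∋-mp (weaken B A) (f a)
    ... | no na = ∋-mp (explosion A B) (∋-¬⁺ na)

    ∋-∧⁺ : ∀ {A B} → Γ ∋ A → Γ ∋ B → Γ ∋ A ∧' B
    ∋-∧⁺ a b = ∋-app (∋-mp (∧-intro _ _) a) b

    ∋-∧ˡ : ∀ {A B} → Γ ∋ A ∧' B → Γ ∋ A
    ∋-∧ˡ = ∋-mp (∧-elimˡ _ _)

    ∋-∧ʳ : ∀ {A B} → Γ ∋ A ∧' B → Γ ∋ B
    ∋-∧ʳ = ∋-mp (∧-elimʳ _ _)

    ∋-∨ˡ : ∀ {A B} → Γ ∋ A → Γ ∋ A ∨' B
    ∋-∨ˡ = ∋-mp (∨-introˡ _ _)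

    ∋-∨ʳ : ∀ {A B} → Γ ∋ B → Γ ∋ A ∨' B
    ∋-∨ʳ = ∋-mp (∨-introʳ _ _)

    ∋-∨⁻ : ∀ {A B} → Γ ∋ A ∨' B → (Γ ∋ A) ⊎ (Γ ∋ B)
    ∋-∨⁻ {A} {B} ab with em {P = Γ ∋ A}
    ... | yes a = inj₁ a
    ... | no na = inj₂ (∋-app (∋-mp (∨-elim A B) ab) (∋-¬⁺ na))

  imp : ∀ {A B} → (∀ Δ → Δ ∋ A → Δ ∋ B) → Thm L (A ⇒ B)
  imp f = valid⇒Thm λ Δ → ∋-⇒⁺ (f Δ)


  module _ {Γ : MCS} where

    □-mp : ∀ {A B} → Γ ∋ □ (A ⇒ B) → Γ ∋ □ A → Γ ∋ □ B
    □-mp {A} {B} f a = ∋-app (∋-mp (subst (σ₃ A B B) ak) f) a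

    □-thm : ∀ {A} → (∀ Δ → Δ ∋ A) → Γ ∋ □ A
    □-thm v = ∋-thm (nec (valid⇒Thm v))

    □-mono : ∀ {A B} → (∀ Δ → Δ ∋ A → Δ ∋ B) → Γ ∋ □ A → Γ ∋ □ B
    □-mono f = □-mp (∋-thm (nec (imp f)))

    □-löb : ∀ {A} → Γ ∋ □ (□ A ⇒ A) → Γ ∋ □ A
    □-löb {A} = ∋-mp (subst (σ₃ A A A) al)

    ▷-J1 : ∀ {A B} → Γ ∋ □ (A ⇒ B) → Γ ∋ A ▷ B
    ▷-J1 {A} {B} = ∋-mp (subst (σ₃ A B B) aj1)

    ▷-imp : ∀ {A B} → (∀ Δ → Δ ∋ A → Δ ∋ B) → Γ ∋ A ▷ B
    ▷-imp f = ▷-J1 (∋-thm (nec (imp f)))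

    ▷-trans : ∀ {A B C} → Γ ∋ A ▷ B → Γ ∋ B ▷ C → Γ ∋ A ▷ C
    ▷-trans {A} {B} {C} ab bc = ∋-mp (subst (σ₃ A B C) aj2) (∋-∧⁺ ab bc)

    ▷-∨ : ∀ {A B C} → Γ ∋ A ▷ C → Γ ∋ B ▷ C → Γ ∋ (A ∨' B) ▷ C
    ▷-∨ {A} {B} {C} ac bc = ∋-mp (subst (σ₃ A B C) aj3) (∋-∧⁺ ac bc)

    ▷-□¬ : ∀ {A B} → Γ ∋ A ▷ B → Γ ∋ □ (¬' B) → Γ ∋ □ (¬' A)
    ▷-□¬ {A} {B} ab nb =
      ∋-¬¬ λ na → ∋-¬⁻ (∋-app (∋-mp (subst (σ₃ A B B) aj4) ab) na) nb

    ▷⊥-□¬ : ∀ {A} → Γ ∋ A ▷ ⊥' → Γ ∋ □ (¬' A)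
    ▷⊥-□¬ a⊥ = ▷-□¬ a⊥ (□-thm λ Δ → ∋-¬⁺ ∋-⊥)

  -- Löb's axiom for `A ∧' □ A`: from `A` one gets `□ (A ∧' □ A) ⇒ A ∧' □ A`.
  □-4 : ∀ {Γ A} → Γ ∋ □ A → Γ ∋ □ (□ A)
  □-4 {Γ} {A} a = □-mono (λ Δ → ∋-∧ʳ) (□-löb (□-mono step a))
    where step : ∀ Δ → Δ ∋ A → Δ ∋ □ (A ∧' □ A) ⇒ A ∧' □ A
          step Δ a = ∋-⇒⁺ λ b → ∋-∧⁺ a (□-mono (λ Δ → ∋-∧ˡ) b)

  -- Successors and critical successors

  infix 3 _≺_ _⊑_

  _≺_ _⊑_ : MCS → MCS → Set
  Γ ≺ Δ = ∀ A → Γ ∋ □ A → (Δ ∋ A) × (Δ ∋ □ A)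
  Γ ⊑ Δ = ∀ A → Γ ∋ □ A → Δ ∋ □ A

  ≺⇒⊑ : ∀ {Γ Δ} → Γ ≺ Δ → Γ ⊑ Δ
  ≺⇒⊑ s A a = proj₂ (s A a)

  ⊑-refl : ∀ {Γ} → Γ ⊑ Γ
  ⊑-refl A a = a

  ⊑-trans : ∀ {Γ Δ Θ} → Γ ⊑ Δ → Δ ⊑ Θ → Γ ⊑ Θ
  ⊑-trans s t A a = t A (s A a)

  ⊑-≺ : ∀ {Γ Δ Θ} → Γ ⊑ Δ → Δ ≺ Θ → Γ ≺ Θ
  ⊑-≺ s t A a = t A (s A a)

  ≺-trans : ∀ {Γ Δ Θ} → Γ ≺ Δ → Δ ≺ Θ → Γ ≺ Θ
  ≺-trans s t = ⊑-≺ (≺⇒⊑ s) t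

  -- Δ is a D-critical successor of Γ.  The second half of Γ ≺ Δ need not be required, because
  -- □ A ∈ Γ gives ¬ A ▷ D and ¬ □ A ▷ D in Γ.
  Crit : MCS → Fm → MCS → Set
  Crit Γ D Δ = ∀ A → Γ ∋ A ▷ D → Δ ∌ A

  crit⇒≺ : ∀ {Γ D Δ} → Crit Γ D Δ → Γ ≺ Δ
  crit⇒≺ {Γ} {D} {Δ} c A a = from a , from (□-4 a)
    where from : ∀ {B} → Γ ∋ □ B → Δ ∋ B
          from b = ∋-¬¬ (c _ (▷-J1 (□-mono (λ _ b → ∋-⇒⁺ λ nb → ⊥-elim (∋-¬⁻ nb b)) b)))

  -- By J4. With `crit⇒≺`, the `⊥'`-critical successors are exactly the `≺`-successors, so witnesses
  -- for `□` are the case `D = ⊥'` of those for `▷`.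
  ≺⇒crit⊥ : ∀ {Γ Δ} → Γ ≺ Δ → Crit Γ ⊥' Δ
  ≺⇒crit⊥ s A a⊥ = ∋-¬⁻ (proj₁ (s _ (▷⊥-□¬ a⊥)))

  crit-self : ∀ {Γ D Δ} → Crit Γ D Δ → Δ ∌ D
  crit-self c = c _ (▷-imp λ _ a → a)

  -- A formula whose negation `▷`-implies `D` is forced in every `D`-critical successor. By J3 these
  -- formulas are closed under modus ponens: where the conclusion fails, the implication or its
  -- premise fails.
  crit-exists : ∀ Γ D B → Γ ∌ B ▷ D → Σ MCS λ Δ → Crit Γ D Δ × Δ ∋ B
  crit-exists Γ D B nbd with lindenbaum 𝓕 (¬' B) (λ h → nbd (▷-trans (▷-imp λ _ b → ∋-¬⁺ λ nb → ∋-¬⁻ nb b) h))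
    where
    𝓕 : Theory
    𝓕 = record
      { has  = λ A → Γ ∋ (¬' A) ▷ D
      ; thms = λ t → ▷-imp λ Δ n → ⊥-elim (∋-¬⁻ n (∋-thm t))
      ; app  = λ {A} {B} f a → ▷-trans
          (▷-imp {B = ¬' (A ⇒ B) ∨' ¬' A} λ Δ nb → split Δ nb)
          (▷-∨ f a) }
      where
      split : ∀ {A B} Δ → Δ ∋ ¬' B → Δ ∋ ¬' (A ⇒ B) ∨' ¬' A
      split {A} {B} Δ nb with em {P = Δ ∋ A}
      ... | yes a = ∋-∨ˡ (∋-¬⁺ λ f → ∋-¬⁻ nb (∋-app f a))
      ... | no na = ∋-∨ʳ (∋-¬⁺ na)
  ... | Δ , inc , nnb = Δ
      , (λ A ad → ∋-¬⁻ (inc (▷-trans (▷-imp λ _ nna → ∋-¬¬ λ na → ∋-¬⁻ nna na) ad)))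
      , ∋-¬¬ nnb

  □-exists : ∀ Γ A → Γ ∌ □ A → Σ MCS λ Δ → (Γ ≺ Δ) × (Δ ∌ A)
  □-exists Γ A na with crit-exists Γ ⊥' (¬' A) (λ h → na (□-mono (λ _ nna → ∋-¬¬ (∋-¬⁻ nna)) (▷⊥-□¬ h)))
  ... | Δ , c , nA = Δ , crit⇒≺ c , ∋-¬⁻ nA

  löb-exists : ∀ Γ A → Γ ∌ □ (¬' A) → Σ MCS λ Δ → (Γ ≺ Δ) × (Δ ∋ A) × (Δ ∋ □ (¬' A))
  löb-exists Γ A na with crit-exists Γ ⊥' (A ∧' □ (¬' A))
      (λ h → na (□-löb (□-mono (λ _ n → ∋-⇒⁺ λ b → ∋-¬⁺ λ a → ∋-¬⁻ n (∋-∧⁺ a b)) (▷⊥-□¬ h))))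
  ... | Δ , c , ab = Δ , crit⇒≺ c , ∋-∧ˡ ab , ∋-∧ʳ ab

  crit-next : ∀ {Γ D Δ B C} → Crit Γ D Δ → Δ ∋ B → Γ ∋ B ▷ C → Σ MCS λ Δ′ → Crit Γ D Δ′ × Δ′ ∋ C
  crit-next c b bc = crit-exists _ _ _ λ cd → c _ (▷-trans bc cd) b

  -- J5 and J2 give `◇ A ▷ D`. This is what lets criticality pass on to successors.
  crit-◇ : Thm L axJ5 → ∀ {Γ D Δ A} → Crit Γ D Δ → Γ ∋ A ▷ D → Δ ∋ □ (¬' A)
  crit-◇ j5 {A = A} c ad = ∋-¬¬ (c _ (▷-trans (∋-thm (subst (σ₃ A A A) j5)) ad))

  crit-persist : Thm L axJ5 → ∀ {Γ D Δ Δ′} → Crit Γ D Δ → Δ ≺ Δ′ → Crit Γ D Δ′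
  crit-persist j5 c s A ad = ∋-¬⁻ (proj₁ (s _ (crit-◇ j5 c ad)))

  -- `𝓖` collects what `C` and the boxes of `Δ` force in a `D`-critical successor. If it were
  -- inconsistent, `(C ∧' □ X) ▷ D` for some `□ X` in `Δ`; M turns `B ▷ C` into
  -- `(B ∧' □ X) ▷ (C ∧' □ X)`, so `Δ`, which contains `B ∧' □ X`, would not be critical.
  crit-next-M : Thm L axM → ∀ {Γ D Δ B C} → Crit Γ D Δ → Δ ∋ B → Γ ∋ B ▷ C →
                Σ MCS λ Δ′ → Crit Γ D Δ′ × (Δ′ ∋ C) × (Δ ⊑ Δ′)
  crit-next-M m {Γ} {D} {Δ} {B} {C} c b bc with lindenbaum 𝓖 ⊥' avoids
    where
    𝓖 : Theory
    𝓖 = record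
      { has  = λ A → Σ Fm λ X → (Δ ∋ □ X) × (Γ ∋ (¬' (C ∧' □ X ⇒ A)) ▷ D)
      ; thms = λ t → ⊤' , □-thm (λ _ → ∋-thm ⊤-intro)
                   , ▷-imp λ Θ n → ⊥-elim (∋-¬⁻ n (∋-⇒⁺ λ _ → ∋-thm t))
      ; app  = λ { {A} {A′} (X , x , f) (Y , y , a) → X ∧' Y
                 , □-mp (□-mono (λ _ x → ∋-⇒⁺ (∋-∧⁺ x)) x) y
                 , ▷-trans (▷-imp (split X Y A A′)) (▷-∨ f a) } }
      where
      split : ∀ X Y A A′ Θ → Θ ∋ ¬' (C ∧' □ (X ∧' Y) ⇒ A′) →
              Θ ∋ ¬' (C ∧' □ X ⇒ (A ⇒ A′)) ∨' ¬' (C ∧' □ Y ⇒ A)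
      split X Y A A′ Θ n with em {P = Θ ∋ C ∧' □ Y ⇒ A}
      ... | no na = ∋-∨ʳ (∋-¬⁺ na)
      ... | yes f = ∋-∨ˡ (∋-¬⁺ λ g → ∋-¬⁻ n (∋-⇒⁺ λ cxy →
              ∋-app (∋-app g (∋-∧⁺ (∋-∧ˡ cxy) (□-mono (λ _ → ∋-∧ˡ) (∋-∧ʳ cxy))))
                    (∋-app f (∋-∧⁺ (∋-∧ˡ cxy) (□-mono (λ _ → ∋-∧ʳ) (∋-∧ʳ cxy))))))
    avoids : ¬ Theory.has 𝓖 ⊥'
    avoids (X , x , h) = c (B ∧' □ X)
      (▷-trans (∋-mp (subst (σ₃ B C X) m) bc)
               (▷-trans (▷-imp λ _ cx → ∋-¬⁺ λ f → ∋-⊥ (∋-app f cx)) h))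
      (∋-∧⁺ b x)
  ... | Δ′ , inc , _ = Δ′
      , (λ A ad → ∋-¬⁻ (inc (⊤' , □-thm (λ _ → ∋-thm ⊤-intro)
          , ▷-trans (▷-imp λ _ n → ∋-¬¬ λ na → ∋-¬⁻ n (∋-⇒⁺ λ _ → na)) ad)))
      , inc (⊤' , □-thm (λ _ → ∋-thm ⊤-intro) , ▷-imp λ _ n → ⊥-elim (∋-¬⁻ n (∋-⇒⁺ ∋-∧ˡ)))
      , (λ X x → inc (X , x , ▷-imp λ _ n → ⊥-elim (∋-¬⁻ n (∋-⇒⁺ ∋-∧ʳ))))

  -- Types over a finite set of formulas

  module Types (Φ : List Fm) where

    literal : MCS → Fm → Fm
    literal Γ A with em {P = Γ ∋ A}
    ... | yes _ = A
    ... | no  _ = ¬' A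

    typeOf : MCS → List Fm → Fm
    typeOf Γ []      = ⊤'
    typeOf Γ (A ∷ l) = literal Γ A ∧' typeOf Γ l

    allTypes : List Fm → List Fm
    allTypes []      = ⊤' ∷ []
    allTypes (A ∷ l) = map (A ∧'_) (allTypes l) ++ map (¬' A ∧'_) (allTypes l)

    θ : MCS → Fm
    θ Γ = typeOf Γ Φ

    typeOf-∈ : ∀ Γ l → typeOf Γ l ∈ allTypes l
    typeOf-∈ Γ []      = here refl
    typeOf-∈ Γ (A ∷ l) with em {P = Γ ∋ A}
    ... | yes _ = ∈-++⁺ˡ (∈-map⁺ (A ∧'_) (typeOf-∈ Γ l))
    ... | no  _ = ∈-++⁺ʳ (map (A ∧'_) (allTypes l)) (∈-map⁺ (¬' A ∧'_) (typeOf-∈ Γ l))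

    typeOf-self : ∀ Γ l → Γ ∋ typeOf Γ l
    typeOf-self Γ []      = ∋-thm ⊤-intro
    typeOf-self Γ (A ∷ l) with em {P = Γ ∋ A}
    ... | yes a = ∋-∧⁺ a (typeOf-self Γ l)
    ... | no na = ∋-∧⁺ (∋-¬⁺ na) (typeOf-self Γ l)

    typeOf-agree : ∀ {Γ Δ A} l → Δ ∋ typeOf Γ l → A ∈ l → (Γ ∋ A → Δ ∋ A) × (Γ ∌ A → Δ ∌ A)
    typeOf-agree {Γ} (A ∷ l) t (here refl) with em {P = Γ ∋ A}
    ... | yes a = (λ _ → ∋-∧ˡ t) , λ na → ⊥-elim (na a)
    ... | no na = (λ a → ⊥-elim (na a)) , λ _ → ∋-¬⁻ (∋-∧ˡ t)
    typeOf-agree (A ∷ l) t (there m) = typeOf-agree l (∋-∧ʳ t) m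

    final : ∀ Γ → Σ MCS λ Δ → ((Δ ≡ Γ) ⊎ (Γ ≺ Δ)) × (Δ ∋ θ Γ) × (Δ ∋ □ (¬' θ Γ))
    final Γ with em {P = Γ ∋ □ (¬' θ Γ)}
    ... | yes b = Γ , inj₁ refl , typeOf-self Γ Φ , b
    ... | no nb with löb-exists Γ (θ Γ) nb
    ...   | Δ , s , t , b = Δ , inj₂ s , t , b

    infix 8 _°
    _° : MCS → MCS
    Γ ° = proj₁ (final Γ)

    °-cases : ∀ Γ → (Γ ° ≡ Γ) ⊎ (Γ ≺ Γ °)
    °-cases Γ = proj₁ (proj₂ (final Γ))

    °-⊑ : ∀ Γ → Γ ⊑ Γ °
    °-⊑ Γ with °-cases Γ
    ... | inj₁ eq = transport (Γ ⊑_) (sym eq) ⊑-refl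
    ... | inj₂ s  = ≺⇒⊑ s

    ≺-° : ∀ {Γ Δ} → Γ ≺ Δ → Γ ≺ Δ °
    ≺-° {Γ} {Δ} s with °-cases Δ
    ... | inj₁ eq = transport (Γ ≺_) (sym eq) s
    ... | inj₂ t  = ≺-trans s t

    module _ {Γ : MCS} {A : Fm} (m : A ∈ Φ) where

      °⁺ : Γ ∋ A → Γ ° ∋ A
      °⁺ = proj₁ (typeOf-agree Φ (proj₁ (proj₂ (proj₂ (final Γ)))) m)

      °⁻ : Γ ∌ A → Γ ° ∌ A
      °⁻ = proj₂ (typeOf-agree Φ (proj₁ (proj₂ (proj₂ (final Γ)))) m)

    infix 3 _⊏_
    _⊏_ : MCS → MCS → Set
    Γ ⊏ Δ = (Γ ⊑ Δ) × Σ Fm λ A → (A ∈ allTypes Φ) × (Γ ∌ □ (¬' A)) × (Δ ∋ □ (¬' A))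

    ⊑-⊏ : ∀ {Γ Δ Θ} → Γ ⊑ Δ → Δ ⊏ Θ → Γ ⊏ Θ
    ⊑-⊏ s (t , A , m , n , y) = ⊑-trans s t , A , m , (λ b → n (s _ b)) , y

    ⊏-⊑ : ∀ {Γ Δ Θ} → Γ ⊏ Δ → Δ ⊑ Θ → Γ ⊏ Θ
    ⊏-⊑ (s , A , m , n , y) t = ⊑-trans s t , A , m , n , t _ y

    -- The newly excluded type is that of `Δ`: it occurs above `Γ`, at `Δ` itself, but nowhere above
    -- `Δ °`.
    ≺⇒⊏° : ∀ {Γ Δ} → Γ ≺ Δ → Γ ⊏ Δ °
    ≺⇒⊏° {Γ} {Δ} s = ≺⇒⊑ (≺-° s) , θ Δ , typeOf-∈ Δ Φ
      , (λ b → ∋-¬⁻ (proj₁ (s _ b)) (typeOf-self Δ Φ)) , proj₂ (proj₂ (proj₂ (final Δ)))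

    openTypes : MCS → List Fm → ℕ
    openTypes Γ []      = 0
    openTypes Γ (A ∷ l) with em {P = Γ ∋ □ (¬' A)}
    ... | yes _ = openTypes Γ l
    ... | no  _ = suc (openTypes Γ l)

    openTypes-mono : ∀ {Γ Δ} → Γ ⊑ Δ → ∀ l → openTypes Δ l ≤ openTypes Γ l
    openTypes-mono s [] = z≤n
    openTypes-mono {Γ} {Δ} s (A ∷ l) with em {P = Γ ∋ □ (¬' A)} | em {P = Δ ∋ □ (¬' A)}
    ... | yes _ | yes _ = openTypes-mono s l
    ... | yes y | no n  = ⊥-elim (n (s _ y))
    ... | no _  | yes _ = m≤n⇒m≤1+n (openTypes-mono s l)
    ... | no _  | no _  = s≤s (openTypes-mono s l)

    openTypes-strict : ∀ {Γ Δ A} → Γ ⊑ Δ → Γ ∌ □ (¬' A) → Δ ∋ □ (¬' A) →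
                   ∀ l → A ∈ l → openTypes Δ l < openTypes Γ l
    openTypes-strict {Γ} {Δ} s n y (A ∷ l) (here refl) with em {P = Γ ∋ □ (¬' A)} | em {P = Δ ∋ □ (¬' A)}
    ... | yes y′ | _     = ⊥-elim (n y′)
    ... | no _   | yes _ = s≤s (openTypes-mono s l)
    ... | no _   | no n′ = ⊥-elim (n′ y)
    openTypes-strict {Γ} {Δ} s n y (B ∷ l) (there m) with em {P = Γ ∋ □ (¬' B)} | em {P = Δ ∋ □ (¬' B)}
    ... | yes _  | yes _ = openTypes-strict s n y l m
    ... | yes y′ | no n′ = ⊥-elim (n′ (s _ y′))
    ... | no _   | yes _ = m≤n⇒m≤1+n (openTypes-strict s n y l m)
    ... | no _   | no _  = s≤s (openTypes-strict s n y l m)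

    ⊏-wf : WellFounded (λ Δ Γ → Γ ⊏ Δ)
    ⊏-wf = Subrelation.wellFounded (λ { (s , A , m , n , y) → openTypes-strict s n y (allTypes Φ) m })
             (On.wellFounded (λ Γ → openTypes Γ (allTypes Φ)) <-wellFounded)

  -- Frames and labelled models

  Closed : {P : Set} → (P → P → Set) → (P → Set) → Set
  Closed S U = ∀ {y z} → S y z → U y → U z

  -- The condition for axiom W at a point with set of successors vis: every inhabited Y ⊆ vis has
  -- a member from which no member of Y can be reached by S-steps inside vis followed by an R-step.
  WCond : {P : Set} → (P → P → Set) → (P → P → Set) → (P → Set) → Set₁
  WCond {P} R S vis = ∀ (Y : P → Set) y → vis y → Y y →
    Σ P λ y′ → vis y′ × Y y′ × Σ (P → Set) λ U → Closed S U × U y′ ×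
      (∀ z → vis z → U z → ∀ t → R z t → ¬ Y t)

  -- The conditions are what soundness of the axioms asks for; `cond-W₀` is the instance of `cond-W`
  -- for a root that sees the whole frame.
  record Frame : Set₁ where
    field
      P       : Set
      R S     : P → P → Set
      R-trans : ∀ {x y z} → R x y → R y z → R x z
      R-wf    : WellFounded (λ y x → R x y)
      cond-J5 : HasJ5 L → ∀ {x y} → R x y → S x y
      cond-M  : HasM L → ∀ {x y z} → S x y → R y z → R x z
      cond-P  : HasP L → ∀ {x y z} → R x y → S y z → R x z
      cond-W₀ : HasW L → WCond R S (λ _ → ⊤)
      cond-W  : HasW L → ∀ x → WCond R S (R x)

  module _ (Φ : List Fm) where

    -- The S-closed sets are the future τ1-open sets. The missing direction for `□` comes from
    -- `root-≺` and `R-≺`. `vis` is everything for the root and `R x` for a point `x`.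
    record Truthful (Γ : MCS) (F : Frame) (lab : Frame.P F → MCS) (vis : Frame.P F → Set) : Set₁ where
      open Frame F
      field
        □⁻ : ∀ A → (□ A) ∈ Φ → Γ ∌ □ A → Σ P λ y → vis y × (lab y ∌ A)
        ▷⁺ : ∀ A B → (A ▷ B) ∈ Φ → Γ ∋ A ▷ B → ∀ U → Closed S U →
             ∀ y → vis y → U y → lab y ∋ A → Σ P λ z → vis z × U z × (lab z ∋ B)
        ▷⁻ : ∀ A B → (A ▷ B) ∈ Φ → Γ ∌ A ▷ B → Σ (P → Set) λ U → Closed S U ×
             (Σ P λ y → vis y × U y × (lab y ∋ A)) × (∀ z → vis z → U z → lab z ∌ B)

    -- A labelled frame that, placed below a root labelled Γ, makes the formulas of Φ true exactly
    -- where they belong to the label.  The root itself is not a point of the frame.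
    record Model (Γ : MCS) : Set₁ where
      field
        frame    : Frame
      open Frame frame public
      field
        lab      : P → MCS
        root-≺   : ∀ y → Γ ≺ lab y
        R-≺      : ∀ {x y} → R x y → lab x ≺ lab y
        truth₀   : Truthful Γ frame lab (λ _ → ⊤)
        truth    : ∀ x → Truthful (lab x) frame lab (R x)

  -- A block with direction D, top Δ and level s is a point labelled by the D-critical successor Δ of G,
  -- with the model of Δ above it.  S-steps leave a block only for the tops of other blocks, and from
  -- above the top only for levels that come earlier in the order lt; hence they never return, and
  -- each S-closed set of a block is the trace of an S-closed set of the glued frame.
  module Gluing
    (Φ : List Fm) (noM : ¬ HasM L) (G : MCS)
    (models : ∀ Δ → G ≺ Δ → Model Φ Δ)
    (Adm : Fm → MCS → ℕ → Set)
    (adm-crit : ∀ {D Δ s} → Adm D Δ s → Crit G D Δ)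
    -- This order adapts the gluing to the logic: reversed `_<_` supplies fresh earlier levels
    -- without end, the empty order forbids jumps (axiom P), and `_<_` makes the levels well-founded
    -- (axiom W).
    (lt : ℕ → ℕ → Set)
    (lt-trans : ∀ {i j k} → lt i j → lt j k → lt i k)
    (lt-irrefl : ∀ {i} → ¬ lt i i)
    -- The direction handed on by a jump from above a top: J5 preserves it, but without J5
    -- criticality is lost there.
    (up : Fm → Fm)
    (up-J5 : HasJ5 L → ∀ D → up D ≡ D)
    (axJ5-thm : HasJ5 L → Thm L axJ5)
    (serve-root : ∀ {D Δ s B C} → Adm D Δ s → (B ▷ C) ∈ Φ → G ∋ B ▷ C → Δ ∋ B →
       Σ MCS λ Δ′ → Σ ℕ λ s′ → Adm D Δ′ s′ × ((s′ ≡ s) ⊎ lt s′ s) × (Δ′ ∋ C))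
    -- Either a jump finds the witness in another block, or the formula holds at the top too and the
    -- block serves it itself.
    (serve-inner : ∀ {D Δ s B C Θ} → Adm D Δ s → (B ▷ C) ∈ Φ → G ∋ B ▷ C → Δ ≺ Θ → Θ ∋ B →
       (Σ MCS λ Δ′ → Σ ℕ λ s′ → Adm (up D) Δ′ s′ × lt s′ s × (Δ′ ∋ C)) ⊎ (Δ ∋ B ▷ C))
    (start : ∀ D B → G ∌ B ▷ D → Σ MCS λ Δ → Σ ℕ λ s → Adm D Δ s × (Δ ∋ B))
    (p-lt : HasP L → ∀ {i j} → ¬ lt i j)
    (w-lt : HasW L → ∀ {i j} → lt i j → i < j)
    where

    record Block : Set where
      field
        dir   : Fm
        top   : MCS
        level : ℕ
        adm   : Adm dir top level
      succ : G ≺ top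
      succ = crit⇒≺ (adm-crit adm)
    open Block

    module M (i : Block) = Model (models (top i) (succ i))

    Point : Set
    Point = Σ Block λ i → Maybe (M.P i)

    label : Point → MCS
    label (i , nothing) = top i
    label (i , just y)  = M.lab i y

    le : Block → Block → Set
    le j i = (level j ≡ level i) ⊎ lt (level j) (level i)

    data GR : Point → Point → Set where
      root  : ∀ {i y} → GR (i , nothing) (i , just y)
      inner : ∀ {i y z} → M.R i y z → GR (i , just y) (i , just z)

    data GS : Point → Point → Set where
      inner : ∀ {i y z} → M.S i y z → GS (i , just y) (i , just z)
      down  : ∀ {i y} → HasJ5 L → GS (i , nothing) (i , just y)
      hop   : ∀ {i j} → dir j ≡ dir i → le j i → GS (i , nothing) (j , nothing)
      jump  : ∀ {i j y} → dir j ≡ up (dir i) → lt (level j) (level i) → GS (i , just y) (j , nothing)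

    data Ext (i : Block) (V : M.P i → Set) : Point → Set where
      here  : ∀ {y} → V y → Ext i V (i , just y)
      below : ∀ {j m} → lt (level j) (level i) → Ext i V (j , m)

    ext-closed : ∀ i {V} → Closed (M.S i) V → Closed GS (Ext i V)
    ext-closed i c (inner s)          (here v)  = here (c s v)
    ext-closed i c (jump _ l)         (here v)  = below l
    ext-closed i c (inner s)          (below b) = below b
    ext-closed i c (down _)           (below b) = below b
    ext-closed i c (hop _ (inj₁ eq))  (below b) = below (transport (λ k → lt k (level i)) (sym eq) b)
    ext-closed i c (hop _ (inj₂ l))   (below b) = below (lt-trans l b)
    ext-closed i c (jump _ l)         (below b) = below (lt-trans l b)

    ext-inner : ∀ {i V y} → Ext i V (i , just y) → V y
    ext-inner (here v)  = v
    ext-inner (below b) = ⊥-elim (lt-irrefl b)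

    restrict-closed : ∀ i {U} → Closed GS U → Closed (M.S i) (λ y → U (i , just y))
    restrict-closed i c s = c (inner s)

    GR-trans : ∀ {x y z} → GR x y → GR y z → GR x z
    GR-trans root      (inner _) = root
    GR-trans (inner {i} r) (inner s) = inner (M.R-trans i r s)

    inner-acc : ∀ i {y} → Acc (λ y x → M.R i x y) y → Acc (λ y x → GR x y) (i , just y)
    inner-acc i (acc rs) = acc λ { (inner r) → inner-acc i (rs r) }

    GR-wf : WellFounded (λ y x → GR x y)
    GR-wf (i , nothing) = acc λ { root → inner-acc i (M.R-wf i _) }
    GR-wf (i , just y)  = inner-acc i (M.R-wf i y)

    WCond-root : HasW L → ∀ i → WCond GR GS (GR (i , nothing))
    WCond-root h i Y (i , just y) root Yy with M.cond-W₀ i h (λ y → Y (i , just y)) y tt Yy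
    ... | y′ , _ , Yy′ , U , c , Uy′ , f =
      (i , just y′) , root , Yy′ , Ext i U , ext-closed i c , here Uy′ ,
      λ { (i , just z) root Uz (i , just t) (inner r) → f z tt (ext-inner Uz) t r }

    WCond-inner : HasW L → ∀ i x → WCond GR GS (GR (i , just x))
    WCond-inner h i x Y (i , just y) (inner v) Yy with M.cond-W i h x (λ y → Y (i , just y)) y v Yy
    ... | y′ , v′ , Yy′ , U , c , Uy′ , f =
      (i , just y′) , inner v′ , Yy′ , Ext i U , ext-closed i c , here Uy′ ,
      λ { (i , just z) (inner v) Uz (i , just t) (inner r) → f z v (ext-inner Uz) t r }

    module _ (h : HasW L) (Y : Point → Set) where

      AtLevel : ℕ → Set
      AtLevel s = Σ Block λ i → (level i ≡ s) × Σ (Maybe (M.P i)) λ m → Y (i , m)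

      least : ∀ s → Acc _<_ s → AtLevel s → Σ ℕ λ s → AtLevel s × (∀ {t} → t < s → ¬ AtLevel t)
      least s (acc rs) a with em {P = Σ ℕ λ t → (t < s) × AtLevel t}
      ... | yes (t , t<s , b) = least t (rs t<s) b
      ... | no none           = s , a , λ t<s b → none (_ , t<s , b)

      -- Earlier levels miss `Y` altogether. If some block of the least level meets `Y` above its
      -- top, the W-condition of that block applies; otherwise a top works, with all blocks of the
      -- same or an earlier level as S-closed set.
      at-least : ∀ s → AtLevel s → (∀ {t} → t < s → ¬ AtLevel t) →
        Σ Point λ y′ → ⊤ × Y y′ × Σ (Point → Set) λ U → Closed GS U × U y′ ×
          (∀ z → ⊤ → U z → ∀ t → GR z t → ¬ Y t)
      at-least s (i , refl , m , Ym) min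
        with em {P = Σ Block λ j → (level j ≡ s) × Σ (M.P j) λ y → Y (j , just y)}
      ... | yes (j , eq , y , Yy) with M.cond-W₀ j h (λ y → Y (j , just y)) y tt Yy
      ...   | y′ , _ , Yy′ , U , c , Uy′ , f =
        (j , just y′) , tt , Yy′ , Ext j U , ext-closed j c , here Uy′ , avoid
        where
        avoid : ∀ z → ⊤ → Ext j U z → ∀ t → GR z t → ¬ Y t
        avoid _ _ (here Uz) _ (inner r) Yt = f _ tt Uz _ r Yt
        avoid _ _ (below b) _ root Yt =
          min (transport (_ <_) eq (w-lt h b)) (_ , refl , _ , Yt)
        avoid _ _ (below b) _ (inner r) Yt =
          min (transport (_ <_) eq (w-lt h b)) (_ , refl , _ , Yt)
      at-least s (i , refl , just y , Yy) min | no none = ⊥-elim (none (i , refl , y , Yy))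
      at-least s (i , refl , nothing , Yi) min | no none =
        (i , nothing) , tt , Yi , (λ x → le (proj₁ x) i) , closed , inj₁ refl , avoid
        where
        closed : Closed GS (λ x → le (proj₁ x) i)
        closed (inner _)           l = l
        closed (down _)            l = l
        closed (hop _ (inj₁ eq))   l = transport (λ k → (k ≡ level i) ⊎ lt k (level i)) (sym eq) l
        closed (hop _ (inj₂ l′))   (inj₁ eq) = inj₂ (transport (lt _) eq l′)
        closed (hop _ (inj₂ l′))   (inj₂ l)  = inj₂ (lt-trans l′ l)
        closed (jump _ l′)         (inj₁ eq) = inj₂ (transport (lt _) eq l′)
        closed (jump _ l′)         (inj₂ l)  = inj₂ (lt-trans l′ l)
        none-inside : ∀ j y → le j i → ¬ Y (j , just y)
        none-inside j y (inj₁ eq) Yy = none (j , eq , y , Yy)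
        none-inside j y (inj₂ l)  Yy = min (w-lt h l) (j , refl , just y , Yy)
        avoid : ∀ z → ⊤ → le (proj₁ z) i → ∀ t → GR z t → ¬ Y t
        avoid _ _ l _ root      = none-inside _ _ l
        avoid _ _ l _ (inner _) = none-inside _ _ l

    WCond-top : HasW L → WCond GR GS (λ _ → ⊤)
    WCond-top h Y (i , m) _ Yy with least h Y (level i) (<-wellFounded _) (i , refl , m , Yy)
    ... | s , a , min = at-least h Y s a min

    gframe : Frame
    gframe = record
      { P = Point ; R = GR ; S = GS ; R-trans = GR-trans ; R-wf = GR-wf
      ; cond-J5 = λ { h root → down h ; h (inner {i} r) → inner (M.cond-J5 i h r) }
      ; cond-M = λ h → ⊥-elim (noM h)
      ; cond-P = λ { h root (inner _) → root
               ; h root (jump _ l) → ⊥-elim (p-lt h l)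
               ; h (inner {i} r) (inner s) → inner (M.cond-P i h r s)
               ; h (inner _) (jump _ l) → ⊥-elim (p-lt h l) }
      ; cond-W₀ = WCond-top
      ; cond-W = λ { h (i , nothing) → WCond-root h i ; h (i , just x) → WCond-inner h i x } }

    inner-truthful : ∀ i {Γ} {vis : M.P i → Set} (vis′ : Point → Set) →
      (∀ {y} → vis y → vis′ (i , just y)) →
      (∀ {z} → vis′ z → Σ (M.P i) λ y → (z ≡ (i , just y)) × vis y) →
      Truthful Φ Γ (M.frame i) (M.lab i) vis → Truthful Φ Γ gframe label vis′
    inner-truthful i vis′ into out T = record
      { □⁻ = λ A mA n → let y , v , na = □⁻ A mA n in (i , just y) , into v , na
      ; ▷⁺ = λ A B mAB ab U c y v Uy a → step A B mAB ab U c y (out v) Uy a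
      ; ▷⁻ = λ A B mAB n → let U , c , (y , v , Uy , a) , f = ▷⁻ A B mAB n in
          Ext i U , ext-closed i c , ((i , just y) , into v , here Uy , a) ,
          λ z v Uz → avoid z (out v) Uz f }
      where
      open Truthful T
      step : ∀ A B → (A ▷ B) ∈ Φ → _ → ∀ U → Closed GS U → ∀ y → Σ (M.P i) (λ y′ → (y ≡ (i , just y′)) × _) →
             U y → label y ∋ A → Σ Point λ z → vis′ z × U z × (label z ∋ B)
      step A B mAB ab U c _ (y , refl , v) Uy a =
        let z , v′ , Uz , b = ▷⁺ A B mAB ab (λ y → U (i , just y)) (restrict-closed i c) y v Uy a
        in (i , just z) , into v′ , Uz , b
      avoid : ∀ {U B} z → Σ (M.P i) (λ y → (z ≡ (i , just y)) × _) → Ext i U z →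
              (∀ z → _ → U z → M.lab i z ∌ B) → label z ∌ B
      avoid _ (z , refl , v) Uz f = f z v (ext-inner Uz)

    -- An S-closed set around the tops with direction `D` on which `D` is false. Without J5 no
    -- S-step leads from a top into a block; with J5 the inside inherits criticality and `up` keeps
    -- the direction.
    Cone : Fm → Point → Set
    Cone D (i , nothing) = dir i ≡ D
    Cone D (i , just _)  = HasJ5 L × (dir i ≡ D)

    cone-closed : ∀ D → Closed GS (Cone D)
    cone-closed D (inner _)   c        = c
    cone-closed D (down h)    c        = h , c
    cone-closed D (hop eq _)  c        = trans eq c
    cone-closed D (jump {i} eq _) (h , c) = trans eq (trans (up-J5 h (dir i)) c)

    cone-avoids : ∀ D z → Cone D z → label z ∌ D
    cone-avoids D (i , nothing) refl = crit-self (adm-crit (adm i))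
    cone-avoids D (i , just y) (h , refl) =
      crit-self (crit-persist (axJ5-thm h) (adm-crit (adm i)) (M.root-≺ i y))

    top-truthful : Truthful Φ G gframe label (λ _ → ⊤)
    top-truthful = record
      { □⁻ = λ A _ n →
          let Δ , s , adm , na = start ⊥' (¬' A)
                (λ h → n (□-mono (λ _ nna → ∋-¬¬ (∋-¬⁻ nna)) (▷⊥-□¬ h)))
          in (block adm , nothing) , tt , ∋-¬⁻ na
      ; ▷⁺ = serve
      ; ▷⁻ = λ A B _ n →
          let Δ , s , adm , a = start B A n
          in Cone B , cone-closed B , ((block adm , nothing) , tt , refl , a) , λ z _ → cone-avoids B z }
      where
      block : ∀ {D Δ s} → Adm D Δ s → Block
      block {D} {Δ} {s} a = record { dir = D ; top = Δ ; level = s ; adm = a }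
      serve : ∀ A B → (A ▷ B) ∈ Φ → G ∋ A ▷ B → ∀ U → Closed GS U →
              ∀ y → ⊤ → U y → label y ∋ A → Σ Point λ z → ⊤ × U z × (label z ∋ B)
      serve A B mAB ab U c (i , nothing) _ Uy a =
        let Δ′ , s′ , adm′ , l , b = serve-root (adm i) mAB ab a
        in (block adm′ , nothing) , tt , c (hop refl l) Uy , b
      serve A B mAB ab U c (i , just y) _ Uy a with serve-inner (adm i) mAB ab (M.root-≺ i y) a
      ... | inj₁ (Δ′ , s′ , adm′ , l , b) = (block adm′ , nothing) , tt , c (jump refl l) Uy , b
      ... | inj₂ ab′ =
        let z , _ , Uz , b = Truthful.▷⁺ (M.truth₀ i) A B mAB ab′ _ (restrict-closed i c) y tt Uy a
        in (i , just z) , tt , Uz , b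

    glued : Model Φ G
    glued = record
      { frame = gframe
      ; lab   = label
      ; root-≺ = λ { (i , nothing) → succ i ; (i , just y) → ≺-trans (succ i) (M.root-≺ i y) }
      ; R-≺   = λ { (root {i} {y}) → M.root-≺ i y ; (inner {i} r) → M.R-≺ i r }
      ; truth₀ = top-truthful
      ; truth = λ { (i , nothing) → inner-truthful i (GR (i , nothing)) (λ _ → root)
                      (λ { root → _ , refl , tt }) (M.truth₀ i)
                  ; (i , just x) → inner-truthful i (GR (i , just x)) inner
                      (λ { (inner r) → _ , refl , r }) (M.truth i x) } }

  -- Ranks for ILW.  An antecedent β = ⋁ B over a finite family of formulas B ▷ C whose
  -- antecedents are not D-negligible satisfies β ▷ ⋁ C ∧ □ ¬ β, so some consequents have
  -- D-critical witnesses above which no antecedent of the family holds; these get the least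
  -- rank, and the remaining members of the family are ranked recursively.

  Pair : Set
  Pair = Fm × Fm

  ⋁ : (Pair → Fm) → List Pair → Fm
  ⋁ f []      = ⊥'
  ⋁ f (k ∷ l) = f k ∨' ⋁ f l

  ∋-⋁⁺ : ∀ {Δ f k} l → k ∈ l → Δ ∋ f k → Δ ∋ ⋁ f l
  ∋-⋁⁺ (k ∷ l) (here refl) a = ∋-∨ˡ a
  ∋-⋁⁺ (k ∷ l) (there m)   a = ∋-∨ʳ (∋-⋁⁺ l m a)

  ∋-⋁⁻ : ∀ {Δ f} l → Δ ∋ ⋁ f l → Σ Pair λ k → (k ∈ l) × (Δ ∋ f k)
  ∋-⋁⁻ []      b = ⊥-elim (∋-⊥ b)
  ∋-⋁⁻ (k ∷ l) b with ∋-∨⁻ b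
  ... | inj₁ a  = k , here refl , a
  ... | inj₂ b′ with ∋-⋁⁻ l b′
  ...   | j , m , a = j , there m , a

  ⋁-▷ : ∀ {Γ f X} l → (∀ k → k ∈ l → Γ ∋ f k ▷ X) → Γ ∋ ⋁ f l ▷ X
  ⋁-▷ []      h = ▷-imp λ _ b → ⊥-elim (∋-⊥ b)
  ⋁-▷ (k ∷ l) h = ▷-∨ (h k (here refl)) (⋁-▷ l λ j m → h j (there m))

  module Ranks (j5 : Thm L axJ5) (w : Thm L axW) (G : MCS) (D : Fm) where

    Extends : Fm → List Pair → Pair → Set
    Extends β ks k = G ∋ (proj₂ k ∧' □ (¬' β) ∧' ¬' ⋁ proj₁ ks) ▷ D

    data Chain (β : Fm) : List Pair → Set where
      []  : Chain β []
      _∷_ : ∀ {k ks} → Extends β ks k → Chain β ks → Chain β (k ∷ ks)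

    -- A consequent either meets an antecedent added to the chain before its own or is negligible by
    -- `Extends`; so the antecedent added last never appears on the right.
    chain-consequent : ∀ {β k ks} → Chain β (k ∷ ks) → ∀ j → j ∈ k ∷ ks →
                       G ∋ (proj₂ j ∧' □ (¬' β)) ▷ (⋁ proj₁ ks ∨' D)
    chain-consequent {β} {k} {ks} (e ∷ _) _ (here refl) =
      ▷-trans (▷-imp {B = (proj₂ k ∧' □ (¬' β) ∧' ¬' ⋁ proj₁ ks) ∨' ⋁ proj₁ ks} split)
              (▷-∨ (▷-trans e (▷-imp λ _ → ∋-∨ʳ)) (▷-imp λ _ → ∋-∨ˡ))
      where
      split : ∀ Δ → Δ ∋ proj₂ k ∧' □ (¬' β) → Δ ∋ (proj₂ k ∧' □ (¬' β) ∧' ¬' ⋁ proj₁ ks) ∨' ⋁ proj₁ ks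
      split Δ cb with em {P = Δ ∋ ⋁ proj₁ ks}
      ... | yes a = ∋-∨ʳ a
      ... | no na = ∋-∨ˡ (∋-∧⁺ (∋-∧ˡ cb) (∋-∧⁺ (∋-∧ʳ cb) (∋-¬⁺ na)))
    chain-consequent (_ ∷ c@(_ ∷ _)) j (there m) = ▷-trans (chain-consequent c j m) (▷-imp λ _ → widen)
      where
      widen : ∀ {Δ A B C} → Δ ∋ A ∨' C → Δ ∋ (B ∨' A) ∨' C
      widen ac with ∋-∨⁻ ac
      ... | inj₁ a = ∋-∨ˡ (∋-∨ʳ a)
      ... | inj₂ c = ∋-∨ʳ c

    -- One round leads from the antecedents to their consequents, W adds `□ (¬' β)`, and
    -- `chain-consequent` leads back to a chain shorter by one. Hence a chain cannot exhaust a
    -- non-empty family with non-negligible antecedents, and `ranking` makes progress.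
    chain-negligible : ∀ {β ks} → Chain β ks → (∀ k → k ∈ ks → G ∋ proj₁ k ▷ proj₂ k) →
                       G ∋ β ▷ (⋁ proj₁ ks ∨' D) → G ∋ β ▷ D
    chain-negligible [] _ h = ▷-trans h (▷-∨ (▷-imp λ _ b → ⊥-elim (∋-⊥ b)) (▷-imp λ _ x → x))
    chain-negligible {β} {k ∷ ks} c@(_ ∷ c′) v h =
      chain-negligible c′ (λ j m → v j (there m)) (▷-trans boxed collapse)
      where
      γ : Fm
      γ = ⋁ proj₂ (k ∷ ks)
      served : G ∋ β ▷ (γ ∨' D)
      served = ▷-trans h (▷-∨
        (▷-trans (⋁-▷ (k ∷ ks) λ j m → ▷-trans (v j m) (▷-imp λ _ → ∋-⋁⁺ {f = proj₂} (k ∷ ks) m))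
                 (▷-imp λ _ → ∋-∨ˡ))
        (▷-imp λ _ → ∋-∨ʳ))
      boxed : G ∋ β ▷ ((γ ∨' D) ∧' □ (¬' β))
      boxed = ∋-mp (subst (σ₃ β (γ ∨' D) D) w) served
      spread : ∀ Δ → Δ ∋ (γ ∨' D) ∧' □ (¬' β) → Δ ∋ ⋁ (λ j → proj₂ j ∧' □ (¬' β)) (k ∷ ks) ∨' D
      spread Δ x with ∋-∨⁻ (∋-∧ˡ x)
      ... | inj₂ y = ∋-∨ʳ y
      ... | inj₁ y with ∋-⋁⁻ (k ∷ ks) y
      ...   | j , m , z = ∋-∨ˡ (∋-⋁⁺ (k ∷ ks) m (∋-∧⁺ z (∋-∧ʳ x)))
      collapse : G ∋ ((γ ∨' D) ∧' □ (¬' β)) ▷ (⋁ proj₁ ks ∨' D)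
      collapse = ▷-trans (▷-imp spread) (▷-∨ (⋁-▷ (k ∷ ks) (chain-consequent c)) (▷-imp λ _ → ∋-∨ʳ))

    record Split (β : Fm) (ks rem : List Pair) : Set where
      field
        chained rest : List Pair
        chain    : Chain β chained
        maximal  : ∀ k → k ∈ rest → ¬ Extends β chained k
        covers   : ∀ k → (k ∈ ks) ⊎ (k ∈ rem) → (k ∈ chained) ⊎ (k ∈ rest)
        chained⊆ : ∀ k → k ∈ chained → (k ∈ ks) ⊎ (k ∈ rem)
        size     : length chained + length rest ≡ length ks + length rem

    length-insert : ∀ (ys : List Pair) {k zs} → length (ys ++ k ∷ zs) ≡ suc (length (ys ++ zs))
    length-insert []       = refl
    length-insert (y ∷ ys) = cong suc (length-insert ys)

    split : ∀ n {β ks} rem → length rem ≡ n → Chain β ks → Split β ks rem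
    split n {β} {ks} rem eq c with em {P = Σ Pair λ k → (k ∈ rem) × Extends β ks k}
    ... | no none = record
      { chained = ks ; rest = rem ; chain = c ; maximal = λ k m e → none (k , m , e)
      ; covers = λ k x → x ; chained⊆ = λ k → inj₁ ; size = refl }
    split zero [] eq c | yes (k , () , e)
    split (suc n) rem eq c | yes (k , m , e) with ∈-∃++ m
    ... | ys , zs , refl = record
      { chained = S.chained ; rest = S.rest ; chain = S.chain ; maximal = S.maximal
      ; covers = λ j x → S.covers j (move j x)
      ; chained⊆ = λ j x → unmove j (S.chained⊆ j x)
      ; size = trans S.size (trans (sym (+-suc _ _)) (cong (_ +_) (sym (length-insert ys)))) }
      where
      module S = Split (split n (ys ++ zs) (suc-injective (trans (sym (length-insert ys)) eq)) (e ∷ c))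
      move : ∀ j → (j ∈ _) ⊎ (j ∈ ys ++ k ∷ zs) → (j ∈ k ∷ _) ⊎ (j ∈ ys ++ zs)
      move j (inj₁ x) = inj₁ (there x)
      move j (inj₂ x) with ∈-++⁻ ys x
      ... | inj₁ y           = inj₂ (∈-++⁺ˡ y)
      ... | inj₂ (here eq)   = inj₁ (here eq)
      ... | inj₂ (there z)   = inj₂ (∈-++⁺ʳ ys z)
      unmove : ∀ j → (j ∈ k ∷ _) ⊎ (j ∈ ys ++ zs) → (j ∈ _) ⊎ (j ∈ ys ++ k ∷ zs)
      unmove j (inj₁ (here eq)) = inj₂ (∈-++⁺ʳ ys (here eq))
      unmove j (inj₁ (there x)) = inj₁ x
      unmove j (inj₂ x) with ∈-++⁻ ys x
      ... | inj₁ y = inj₂ (∈-++⁺ˡ y)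
      ... | inj₂ z = inj₂ (∈-++⁺ʳ ys (there z))

    -- An antecedent true at a top may be served by a hop within its level; one possible above the
    -- top requires a jump to a strictly lower level.
    Fits : List Pair → (Pair → ℕ) → MCS → ℕ → Set
    Fits J ρ Δ s = ∀ k → k ∈ J → (Δ ∋ proj₁ k → ρ k ≤ s) × (Δ ∌ □ (¬' proj₁ k) → ρ k < s)

    Ranking : List Pair → ℕ → Set
    Ranking J s = Σ (Pair → ℕ) λ ρ → Σ ℕ λ N → ∀ k → k ∈ J → (s ≤ ρ k) × (ρ k < N) ×
                  Σ MCS λ Δ → Crit G D Δ × (Δ ∋ proj₂ k) × Fits J ρ Δ (ρ k)

    ranking : ∀ n J s → length J ≤ n → (∀ k → k ∈ J → (G ∋ proj₁ k ▷ proj₂ k) × (G ∌ proj₁ k ▷ D)) →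
              Ranking J s
    ranking n [] s _ _ = (λ _ → 0) , 0 , λ _ ()
    ranking (suc n) J@(j ∷ J′) s (s≤s len) v = ρ , suc s + N , ranked
      where
      β : Fm
      β = ⋁ proj₁ J
      module S = Split (split (length J) {β} {[]} J refl [])
      valid : ∀ k → k ∈ S.chained → k ∈ J
      valid k m with S.chained⊆ k m
      ... | inj₂ x = x
      non-empty : ¬ S.rest ≡ []
      non-empty eq = proj₂ (v j (here refl)) (▷-trans (▷-imp λ _ → ∋-∨ˡ)
        (chain-negligible S.chain (λ k m → proj₁ (v k (valid k m)))
          (▷-imp λ Δ b → let k , m , x = ∋-⋁⁻ J b in ∋-∨ˡ (∋-⋁⁺ S.chained (all-chained k m) x))))
        where
        all-chained : ∀ k → k ∈ J → k ∈ S.chained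
        all-chained k m with S.covers k (inj₂ m)
        ... | inj₁ x = x
        ... | inj₂ x with transport (k ∈_) eq x
        ...   | ()
      shorter : length S.chained ≤ n
      shorter = aux S.rest non-empty S.size
        where
        aux : ∀ l → ¬ l ≡ [] → length S.chained + length l ≡ suc (length J′) → length S.chained ≤ n
        aux []      ne _  = ⊥-elim (ne refl)
        aux (_ ∷ l) ne eq = ≤-trans (≤-trans (m≤m+n _ (length l))
          (≤-reflexive (suc-injective (trans (sym (+-suc _ _)) eq)))) len
      rec : Ranking S.chained (suc s)
      rec = ranking n S.chained (suc s) shorter λ k m → v k (valid k m)
      ρ′ : Pair → ℕ
      ρ′ = proj₁ rec
      N : ℕ
      N = proj₁ (proj₂ rec)
      ρ : Pair → ℕ
      ρ k with em {P = k ∈ S.rest}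
      ... | yes _ = s
      ... | no  _ = ρ′ k
      ranked : ∀ k → k ∈ J → (s ≤ ρ k) × (ρ k < suc s + N) ×
               Σ MCS λ Δ → Crit G D Δ × (Δ ∋ proj₂ k) × Fits J ρ Δ (ρ k)
      ranked k m with em {P = k ∈ S.rest}
      -- The witness given by maximality excludes all of `β` above itself and the chained
      -- antecedents at itself; only antecedents of the rest, of rank `s`, can hold there.
      ... | yes mr with crit-exists G D _ (S.maximal k mr)
      ...   | Δ , c , x = ≤-refl , m≤m+n (suc s) N , Δ , c , ∋-∧ˡ x , fits
        where
        fits : Fits J ρ Δ s
        fits i mi with em {P = i ∈ S.rest}
        ... | yes _ = (λ _ → ≤-refl)
          , λ ne → ⊥-elim (ne (□-mono (λ _ nb → ∋-¬⁺ λ b → ∋-¬⁻ nb (∋-⋁⁺ J mi b)) (∋-∧ˡ (∋-∧ʳ x))))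
        ... | no nr = (λ b → ⊥-elim (∋-¬⁻ (∋-∧ʳ (∋-∧ʳ x)) (∋-⋁⁺ S.chained (chained i mi nr) b)))
          , λ ne → ⊥-elim (ne (□-mono (λ _ nb → ∋-¬⁺ λ b → ∋-¬⁻ nb (∋-⋁⁺ J mi b)) (∋-∧ˡ (∋-∧ʳ x))))
          where
          chained : ∀ i → i ∈ J → ¬ (i ∈ S.rest) → i ∈ S.chained
          chained i mi nr with S.covers i (inj₂ mi)
          ... | inj₁ y = y
          ... | inj₂ y = ⊥-elim (nr y)
      ranked k m | no nr with S.covers k (inj₂ m)
      ... | inj₂ y = ⊥-elim (nr y)
      ... | inj₁ y with proj₂ (proj₂ rec) k y
      ...   | s<ρ , ρ<N , Δ , c , x , f = <⇒≤ s<ρ , ≤-trans ρ<N (m≤n+m N (suc s)) , Δ , c , x , fits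
        where
        fits : Fits J ρ Δ (ρ′ k)
        fits i mi with em {P = i ∈ S.rest}
        ... | yes _ = (λ _ → <⇒≤ s<ρ) , λ _ → s<ρ
        ... | no nri with S.covers i (inj₂ mi)
        ...   | inj₁ z = f i z
        ...   | inj₂ z = ⊥-elim (nri z)

  -- Weak completeness by gluing

  module Weak (Φ : List Fm) where

    open Types Φ

    Step : Set₁
    Step = ∀ G → (∀ Δ → G ≺ Δ → Model Φ Δ) → Model Φ G

    -- A model reads only boxes and members of `Φ` from its root label.
    from-° : ∀ {Γ} → Model Φ (Γ °) → Model Φ Γ
    from-° {Γ} M = record
      { frame  = frame ; lab = lab
      ; root-≺ = λ y → ⊑-≺ (°-⊑ Γ) (root-≺ y)
      ; R-≺    = R-≺
      ; truth₀ = record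
          { □⁻ = λ A mA n → T.□⁻ A mA (°⁻ mA n)
          ; ▷⁺ = λ A B mA a → T.▷⁺ A B mA (°⁺ mA a)
          ; ▷⁻ = λ A B mA n → T.▷⁻ A B mA (°⁻ mA n) }
      ; truth = truth }
      where
      open Model M
      module T = Truthful truth₀

    by-steps : Step → ∀ Γ → Model Φ Γ
    by-steps step Γ = go Γ (⊏-wf (Γ °))
      where
      go : ∀ Γ → Acc (λ Δ Γ → Γ ⊏ Δ) (Γ °) → Model Φ Γ
      go Γ (acc rs) = from-° (step (Γ °) λ Δ s → go Δ (rs (≺⇒⊏° s)))

    step-CL : ¬ HasJ5 L → ¬ HasM L → ¬ HasP L → ¬ HasW L → Step
    step-CL noJ5 noM noP noW G models = Gluing.glued Φ noM G models
      (λ D Δ _ → Crit G D Δ) (λ c → c) (λ i j → j < i) (λ a b → <-trans b a) (<-irrefl refl)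
      (λ _ → ⊥') (λ h → ⊥-elim (noJ5 h)) (λ h → ⊥-elim (noJ5 h))
      (λ {_} {_} {s} c _ bc b → let Δ , c′ , x = crit-next c b bc in Δ , s , c′ , inj₁ refl , x)
      (λ {_} {_} {s} c _ bc t b →
        let Δ , c′ , x = crit-next (≺⇒crit⊥ (≺-trans (crit⇒≺ c) t)) b bc
        -- The order is reversed, so raising the level makes the jump irreversible.
        in inj₁ (Δ , suc s , c′ , n<1+n s , x))
      (λ D B n → let Δ , c , x = crit-exists G D B n in Δ , 0 , c , x)
      (λ h → ⊥-elim (noP h)) (λ h → ⊥-elim (noW h))

    step-IL : Thm L axJ5 → ¬ HasM L → ¬ HasP L → ¬ HasW L → Step
    step-IL j5 noM noP noW G models = Gluing.glued Φ noM G models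
      (λ D Δ _ → Crit G D Δ) (λ c → c) (λ i j → j < i) (λ a b → <-trans b a) (<-irrefl refl)
      (λ D → D) (λ _ _ → refl) (λ _ → j5)
      (λ {_} {_} {s} c _ bc b → let Δ , c′ , x = crit-next c b bc in Δ , s , c′ , inj₁ refl , x)
      (λ {_} {_} {s} c _ bc t b →
        let Δ , c′ , x = crit-next (crit-persist j5 c t) b bc in inj₁ (Δ , suc s , c′ , n<1+n s , x))
      (λ D B n → let Δ , c , x = crit-exists G D B n in Δ , 0 , c , x)
      (λ h → ⊥-elim (noP h)) (λ h → ⊥-elim (noW h))

    -- P puts `□ (B ▷ C)` into `G`, hence `B ▷ C` into every top, and each block serves it without a
    -- jump.
    step-ILP : Thm L axJ5 → Thm L axP → ¬ HasM L → ¬ HasW L → Step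
    step-ILP j5 ap noM noW G models = Gluing.glued Φ noM G models
      (λ D Δ _ → Crit G D Δ) (λ c → c) (λ _ _ → ⊥) (λ ()) (λ ())
      (λ D → D) (λ _ _ → refl) (λ _ → j5)
      (λ {_} {_} {s} c _ bc b → let Δ , c′ , x = crit-next c b bc in Δ , s , c′ , inj₁ refl , x)
      (λ {_} {_} {_} {B} {C} c _ bc _ _ →
        inj₂ (proj₁ (crit⇒≺ c _ (∋-mp (subst (σ₃ B C C) ap) bc))))
      (λ D B n → let Δ , c , x = crit-exists G D B n in Δ , 0 , c , x)
      (λ _ ()) (λ h → ⊥-elim (noW h))

    arrow : Fm → List Pair
    arrow (B ▷ C) = (B , C) ∷ []
    arrow _       = []

    arrows : List Fm → List Pair
    arrows []      = []
    arrows (A ∷ l) = arrow A ++ arrows l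

    ∈-arrows : ∀ {B C} l → (B ▷ C) ∈ l → (B , C) ∈ arrows l
    ∈-arrows (_ ∷ l) (here refl) = here refl
    ∈-arrows (A ∷ l) (there m)   = ∈-++⁺ʳ (arrow A) (∈-arrows l m)

    step-ILW : Thm L axJ5 → Thm L axW → ¬ HasM L → ¬ HasP L → Step
    step-ILW j5 aw noM noP G models = Gluing.glued Φ noM G models
      Adm proj₁ _<_ <-trans (<-irrefl refl) (λ D → D) (λ _ _ → refl) (λ _ → j5)
      serve-root serve-inner start (λ h → ⊥-elim (noP h)) (λ _ l → l)
      where
      -- Formulas with a `D`-negligible antecedent are left out: the antecedent is false at
      -- `D`-critical successors and, by J5, above them.
      Active : Fm → Pair → Set
      Active D k = (G ∋ proj₁ k ▷ proj₂ k) × (G ∌ proj₁ k ▷ D)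
      active? : ∀ D k → Dec (Active D k)
      active? D k = em
      K : Fm → List Pair
      K D = filter (active? D) (arrows Φ)
      ∈-K : ∀ {D B C} → (B ▷ C) ∈ Φ → G ∋ B ▷ C → G ∌ B ▷ D → (B , C) ∈ K D
      ∈-K {D} m bc n = ∈-filter⁺ (active? D) (∈-arrows Φ m) (bc , n)
      open Ranks j5 aw G using (Fits; Ranking; ranking)
      ranks : ∀ D → Ranking D (K D) 0
      ranks D = ranking D (length (K D)) (K D) 0 ≤-refl λ k m → proj₂ (∈-filter⁻ (active? D) {xs = arrows Φ} m)
      ρ : Fm → Pair → ℕ
      ρ D = proj₁ (ranks D)
      Adm : Fm → MCS → ℕ → Set
      Adm D Δ s = Crit G D Δ × Fits D (K D) (ρ D) Δ s
      served : ∀ {D B C} → (B , C) ∈ K D → Σ MCS λ Δ → Adm D Δ (ρ D (B , C)) × (Δ ∋ C)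
      served {D} m = let _ , _ , Δ , c , x , f = proj₂ (proj₂ (ranks D)) _ m in Δ , (c , f) , x
      serve-root : ∀ {D Δ s B C} → Adm D Δ s → (B ▷ C) ∈ Φ → G ∋ B ▷ C → Δ ∋ B →
        Σ MCS λ Δ′ → Σ ℕ λ s′ → Adm D Δ′ s′ × ((s′ ≡ s) ⊎ (s′ < s)) × (Δ′ ∋ C)
      serve-root {D} (c , f) m bc b =
        let k = ∈-K {D} m bc (λ h → c _ h b)
            Δ′ , a , x = served k
        in Δ′ , _ , a , swap (m≤n⇒m<n∨m≡n (proj₁ (f _ k) b)) , x
      serve-inner : ∀ {D Δ s B C Θ} → Adm D Δ s → (B ▷ C) ∈ Φ → G ∋ B ▷ C → Δ ≺ Θ → Θ ∋ B →
        (Σ MCS λ Δ′ → Σ ℕ λ s′ → Adm D Δ′ s′ × (s′ < s) × (Δ′ ∋ C)) ⊎ (Δ ∋ B ▷ C)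
      serve-inner {D} (c , f) m bc t b =
        let n = λ h → ∋-¬⁻ (proj₁ (t _ h)) b
            k = ∈-K {D} m bc (λ h → n (crit-◇ j5 c h))
            Δ′ , a , x = served k
        in inj₁ (Δ′ , _ , a , proj₂ (f _ k) n , x)
      start : ∀ D B → G ∌ B ▷ D → Σ MCS λ Δ → Σ ℕ λ s → Adm D Δ s × (Δ ∋ B)
      start D B n =
        let Δ , c , x = crit-exists G D B n
            ρ<N = λ k m → proj₁ (proj₂ (proj₂ (proj₂ (ranks D)) k m))
        -- The level is the strict bound on all ranks, so an arbitrary critical successor fits.
        in Δ , proj₁ (proj₂ (ranks D)) , (c , λ k m → (λ _ → <⇒≤ (ρ<N k m)) , λ _ → ρ<N k m) , x

  -- Unravelling for CLM and ILM

  module Unravelling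
    (am : Thm L axM) (axJ5-thm : HasJ5 L → Thm L axJ5) (noP : ¬ HasP L) (noW : ¬ HasW L)
    (Φ : List Fm) (antecedent : ∀ {A B} → (A ▷ B) ∈ Φ → A ∈ Φ) (Γ₀ : MCS) where

    open Types Φ

    -- A point is the history of its creation.  new w D Δ is a D-critical successor of w (nothing
    -- being the root); jmp w d t Δ is the successor of w that the point t above w sees by an
    -- S-step, so that a formula B ▷ C of w with B true at t has C true at the new point.
    data Tree : Set where
      new : Maybe Tree → Fm → MCS → Tree
      jmp : Maybe Tree → Maybe Fm → Tree → MCS → Tree

    lab : Tree → MCS
    lab (new _ _ Δ)   = Δ
    lab (jmp _ _ _ Δ) = Δ

    labM : Maybe Tree → MCS
    labM nothing  = Γ₀
    labM (just t) = lab t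

    par : Tree → Maybe Tree
    par (new w _ _)   = w
    par (jmp w _ _ _) = w

    dir : Tree → Maybe Fm
    dir (new _ D _)   = just D
    dir (jmp _ d _ _) = d

    -- Criticality is inherited along R exactly in the presence of J5.
    up : Maybe Fm → Maybe Fm
    up nothing = nothing
    up (just D) with em {P = HasJ5 L}
    ... | yes _ = just D
    ... | no  _ = nothing

    pick : {A : Set} → Maybe Fm → A → A → A
    pick nothing  _ y = y
    pick (just _) x y with em {P = HasJ5 L}
    ... | yes _ = y
    ... | no  _ = x

    up-J5 : HasJ5 L → ∀ d → up d ≡ d
    up-J5 h nothing = refl
    up-J5 h (just D) with em {P = HasJ5 L}
    ... | yes _ = refl
    ... | no n  = ⊥-elim (n h)

    up-noJ5 : ¬ HasJ5 L → ∀ d → up d ≡ nothing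
    up-noJ5 n nothing = refl
    up-noJ5 n (just D) with em {P = HasJ5 L}
    ... | yes h = ⊥-elim (n h)
    ... | no _  = refl

    up-idem : ∀ d → up (up d) ≡ up d
    up-idem d with em {P = HasJ5 L}
    ... | yes h = up-J5 h (up d)
    ... | no n  = trans (up-noJ5 n (up d)) (sym (up-noJ5 n d))

    pick-cases : ∀ d → (∀ {A : Set} (x y : A) → pick d x y ≡ y) ⊎
                 ((¬ HasJ5 L) × (Σ Fm λ D → d ≡ just D) × (∀ {A : Set} (x y : A) → pick d x y ≡ x))
    pick-cases nothing = inj₁ λ _ _ → refl
    pick-cases (just D) with em {P = HasJ5 L}
    ... | yes _ = inj₁ λ _ _ → refl
    ... | no n  = inj₂ (n , (D , refl) , λ _ _ → refl)

    -- St w d t: a path of R- and S-steps leads from w to t, entering through a d-critical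
    -- successor of w; d becomes up d at later R-steps, and is nothing if the first step is an S-step.
    data St (w : Maybe Tree) : Maybe Fm → Tree → Set where
      new-here : ∀ {D Δ} → St w (just D) (new w D Δ)
      new-base : ∀ {s e d D Δ} → St w e s → up e ≡ d → St w d (new (just s) D Δ)
      jmp-here : ∀ {d t Δ} → St w d (jmp w d t Δ)
      jmp-base : ∀ {s e d D t Δ} → St w e s → up e ≡ d → St w d (jmp (just s) D t Δ)
      start    : ∀ {v d t Δ} → w ≡ just t → St w nothing (jmp v d t Δ)
      src      : ∀ {v e d t Δ} → St w d t → St w d (jmp v e t Δ)

    -- Paths of R- and S-steps whose last step goes from parent to child. Absorbing the S-steps
    -- before it builds in the condition for M.
    TR : Maybe Tree → Tree → Set
    TR w t = (par t ≡ w) ⊎ Σ Tree λ s → (par t ≡ just s) × Σ (Maybe Fm) λ d → St w d s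

    st-here : ∀ {w} t → par t ≡ w → St w (dir t) t
    st-here (new _ _ _)   refl = new-here
    st-here (jmp _ _ _ _) refl = jmp-here

    st-base : ∀ {w s e d} t → par t ≡ just s → St w e s → up e ≡ d → St w d t
    st-base (new _ _ _)   refl = new-base
    st-base (jmp _ _ _ _) refl = jmp-base

    St-St : ∀ {w e s d t} → St w e s → St (just s) d t → St w e t ⊎ St w (up e) t
    St-St x new-here = inj₂ (new-base x refl)
    St-St x jmp-here = inj₂ (jmp-base x refl)
    St-St {e = e} x (new-base y eq) with St-St x y
    ... | inj₁ z = inj₂ (new-base z refl)
    ... | inj₂ z = inj₂ (new-base z (up-idem e))
    St-St {e = e} x (jmp-base y eq) with St-St x y
    ... | inj₁ z = inj₂ (jmp-base z refl)
    ... | inj₂ z = inj₂ (jmp-base z (up-idem e))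
    St-St x (start refl) = inj₁ (src x)
    St-St x (src y) with St-St x y
    ... | inj₁ z = inj₁ (src z)
    ... | inj₂ z = inj₂ (src z)

    St-TR : ∀ {w e s t} → St w e s → TR (just s) t → St w (up e) t
    St-TR {t = t} x (inj₁ eq) = st-base t eq x refl
    St-TR {e = e} {t = t} x (inj₂ (s , eq , d , y)) with St-St x y
    ... | inj₁ z = st-base t eq z refl
    ... | inj₂ z = st-base t eq z (up-idem e)

    TR-St : ∀ {w} t → TR w t → Σ (Maybe Fm) λ d → St w d t
    TR-St t (inj₁ eq)                = dir t , st-here t eq
    TR-St t (inj₂ (s , eq , d , x)) = up d , st-base t eq x refl

    St-TR-TR : ∀ {w e s} t → St w e s → TR (just s) t → TR w t
    St-TR-TR t x (inj₁ eq) = inj₂ (_ , eq , _ , x)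
    St-TR-TR t x (inj₂ (s , eq , d , y)) with St-St x y
    ... | inj₁ z = inj₂ (s , eq , _ , z)
    ... | inj₂ z = inj₂ (s , eq , _ , z)

    TR-root : ∀ t → TR nothing t
    TR-root (new nothing _ _)    = inj₁ refl
    TR-root (new (just s) _ _)   = inj₂ (s , refl , TR-St s (TR-root s))
    TR-root (jmp nothing _ _ _)  = inj₁ refl
    TR-root (jmp (just s) _ _ _) = inj₂ (s , refl , TR-St s (TR-root s))

    size : Tree → ℕ
    size (new nothing _ _)    = 1
    size (new (just s) _ _)   = suc (size s)
    size (jmp nothing _ t _)  = suc (size t)
    size (jmp (just s) _ t _) = suc (size s + size t)

    St-size : ∀ {v d t} → St (just v) d t → size v < size t
    St-size new-here                           = n<1+n _
    St-size (new-base x _)                     = m≤n⇒m≤1+n (St-size x)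
    St-size (jmp-here {t = t})                 = s≤s (m≤m+n _ (size t))
    St-size (jmp-base {t = t} x _)             = m≤n⇒m≤1+n (≤-trans (St-size x) (m≤m+n _ (size t)))
    St-size (start {v = nothing} refl)         = n<1+n _
    St-size (start {v = just s} {t = t} refl)  = s≤s (m≤n+m (size t) (size s))
    St-size (src {v = nothing} x)              = m≤n⇒m≤1+n (St-size x)
    St-size (src {v = just s} {t = t} x)       = m≤n⇒m≤1+n (≤-trans (St-size x) (m≤n+m (size t) (size s)))

    St-irrefl : ∀ {d t} → ¬ St (just t) d t
    St-irrefl x = <-irrefl refl (St-size x)

    TR-irrefl : ∀ {t} → ¬ TR (just t) t
    TR-irrefl {t} r = St-irrefl (proj₂ (TR-St t r))

    CritM : Maybe Tree → Maybe Fm → MCS → Set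
    CritM w nothing  Δ = Crit (labM w) ⊥' Δ
    CritM w (just D) Δ = Crit (labM w °) D Δ

    -- A jump starts from `Γ °` whenever this keeps criticality. In a direction `D` without J5 the
    -- passage to `Γ °` may lose it, so `Γ` is kept.
    next : Maybe Fm → MCS → MCS
    next d Γ = pick d Γ (Γ °)

    mutual
      Valid : Tree → Set
      Valid (new w D Δ)   = ValidM w × Crit (labM w °) D Δ
      Valid (jmp w d t Δ) = ValidM w × Valid t × TR w t × St w d t × CritM w d Δ × (next d (lab t) ⊑ Δ)

      ValidM : Maybe Tree → Set
      ValidM nothing  = ⊤
      ValidM (just t) = Valid t

    -- Criticality is read off a path and must not depend on its choice. Incompatible paths would
    -- put a point above itself, against `size`; a jump agrees with its source because `Valid` gives
    -- the source an entry with the same `d`.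
    unique : ∀ {w d e} t → Valid t → St w d t → St w e t → d ≡ e
    unique (new _ _ _)        v        new-here        new-here        = refl
    unique (new (just s) _ _) v        new-here        (new-base y _)  = ⊥-elim (St-irrefl y)
    unique (new (just s) _ _) v        (new-base x _)  new-here        = ⊥-elim (St-irrefl x)
    unique (new (just s) _ _) (v , _)  (new-base x eq) (new-base y eq′) =
      trans (sym eq) (trans (cong up (unique s v x y)) eq′)
    unique (jmp _ _ _ _)        v       jmp-here       jmp-here        = refl
    unique (jmp (just s) _ _ _) v       jmp-here       (jmp-base y _)  = ⊥-elim (St-irrefl y)
    unique (jmp (just s) _ _ _) v       (jmp-base x _) jmp-here        = ⊥-elim (St-irrefl x)
    unique (jmp _ _ _ _) (_ , _ , r , _) jmp-here      (start refl)    = ⊥-elim (TR-irrefl r)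
    unique (jmp _ _ _ _) (_ , _ , r , _) (start refl)  jmp-here        = ⊥-elim (TR-irrefl r)
    unique (jmp _ _ t _) (_ , v , _ , z , _) jmp-here  (src y)         = unique t v z y
    unique (jmp _ _ t _) (_ , v , _ , z , _) (src x)   jmp-here        = unique t v x z
    unique (jmp (just s) _ _ _) (v , _) (jmp-base x eq) (jmp-base y eq′) =
      trans (sym eq) (trans (cong up (unique s v x y)) eq′)
    unique (jmp (just s) _ _ _) (_ , _ , r , _) (jmp-base x _) (start refl) = ⊥-elim (St-irrefl (St-TR x r))
    unique (jmp (just s) _ _ _) (_ , _ , r , _) (start refl) (jmp-base y _) = ⊥-elim (St-irrefl (St-TR y r))
    unique (jmp (just s) _ t _) (_ , v , r , _) (jmp-base x eq) (src y) =
      trans (sym eq) (unique t v (St-TR x r) y)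
    unique (jmp (just s) _ t _) (_ , v , r , _) (src x) (jmp-base y eq) =
      trans (unique t v x (St-TR y r)) eq
    unique (jmp _ _ _ _) v (start _)    (start _)    = refl
    unique (jmp _ _ _ _) v (start refl) (src y)      = ⊥-elim (St-irrefl y)
    unique (jmp _ _ _ _) v (src x)      (start refl) = ⊥-elim (St-irrefl x)
    unique (jmp _ _ t _) (_ , v , _) (src x) (src y) = unique t v x y

    CritM⇒≺ : ∀ w d {Δ} → CritM w d Δ → labM w ≺ Δ
    CritM⇒≺ w nothing  c = crit⇒≺ c
    CritM⇒≺ w (just D) c = ⊑-≺ (°-⊑ (labM w)) (crit⇒≺ c)

    child-crit : ∀ t → Valid t → CritM (par t) (dir t) (lab t)
    child-crit (new _ _ _)   (_ , c)                 = c
    child-crit (jmp _ _ _ _) (_ , _ , _ , _ , c , _) = c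

    child-≺ : ∀ t → Valid t → labM (par t) ≺ lab t
    child-≺ t v = CritM⇒≺ (par t) (dir t) (child-crit t v)

    ⊑-next : ∀ d Γ → Γ ⊑ next d Γ
    ⊑-next d Γ with pick-cases d
    ... | inj₁ eq           = transport (Γ ⊑_) (sym (eq Γ (Γ °))) (°-⊑ Γ)
    ... | inj₂ (_ , _ , eq) = transport (Γ ⊑_) (sym (eq Γ (Γ °))) ⊑-refl

    valid-par : ∀ {s} t → Valid t → par t ≡ just s → Valid s
    valid-par (new _ _ _)   (v , _) refl = v
    valid-par (jmp _ _ _ _) (v , _) refl = v

    St-⊑ : ∀ {w d} t → Valid t → St w d t → labM w ⊑ lab t
    St-⊑ t v new-here = ≺⇒⊑ (child-≺ t v)
    St-⊑ t v jmp-here = ≺⇒⊑ (child-≺ t v)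
    St-⊑ t@(new (just s) _ _)   v (new-base x _) = ⊑-trans (St-⊑ s (proj₁ v) x) (≺⇒⊑ (child-≺ t v))
    St-⊑ t@(jmp (just s) _ _ _) v (jmp-base x _) = ⊑-trans (St-⊑ s (proj₁ v) x) (≺⇒⊑ (child-≺ t v))
    St-⊑ (jmp _ d t _) (_ , _ , _ , _ , _ , b) (start refl) = ⊑-trans (⊑-next d (lab t)) b
    St-⊑ (jmp _ d t _) (_ , v , _ , _ , _ , b) (src x) =
      ⊑-trans (St-⊑ t v x) (⊑-trans (⊑-next d (lab t)) b)

    TR-≺ : ∀ {w} t → Valid t → TR w t → labM w ≺ lab t
    TR-≺ {w} t v (inj₁ refl)            = child-≺ t v
    TR-≺ {w} t v (inj₂ (s , eq , _ , x)) =
      ⊑-≺ (St-⊑ s (valid-par t v eq) x) (transport (λ u → labM u ≺ lab t) eq (child-≺ t v))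

    up-just : ∀ e {D} → HasJ5 L → up e ≡ just D → e ≡ just D
    up-just e h eq = trans (sym (up-J5 h e)) eq

    -- A jump with another base inherits only boxes from its source and may itself fail to be
    -- critical for `w`. Hence the induction speaks of the sets above `lab t`, which is a matter of
    -- boxes alone.
    cone-crit : HasJ5 L → ∀ {w D} t → Valid t → St w (just D) t →
                ∀ Δ → lab t ≺ Δ → Crit (labM w °) D Δ
    cone-crit h t v new-here Δ s = crit-persist (axJ5-thm h) (child-crit t v) s
    cone-crit h t v jmp-here Δ s = crit-persist (axJ5-thm h) (child-crit t v) s
    cone-crit h t@(new (just s) _ _) v (new-base {e = e} x eq) Δ l with up-just e h eq
    ... | refl = cone-crit h s (proj₁ v) x Δ (≺-trans (child-≺ t v) l)
    cone-crit h t@(jmp (just s) _ _ _) v (jmp-base {e = e} x eq) Δ l with up-just e h eq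
    ... | refl = cone-crit h s (proj₁ v) x Δ (≺-trans (child-≺ t v) l)
    cone-crit h (jmp _ d t _) (_ , v , _ , _ , _ , b) (src x) Δ l =
      cone-crit h t v x Δ (⊑-≺ (⊑-trans (⊑-next d (lab t)) b) l)

    critical : ∀ {w d} t → Valid t → TR w t → St w d t → CritM w d (lab t)
    critical {w} t v (inj₁ refl) x = transport (λ d → CritM w d (lab t)) (unique t v (st-here t refl) x) (child-crit t v)
    critical {w} {d} t v r@(inj₂ (s , eq , e , y)) x
      with unique t v x (st-base t eq y refl) | em {P = HasJ5 L}
    ... | refl | no n  = transport (λ d → CritM w d (lab t)) (sym (up-noJ5 n e)) (≺⇒crit⊥ (TR-≺ t v r))
    ... | refl | yes h = transport (λ d → CritM w d (lab t)) (sym (up-J5 h e)) (by e y)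
      where
      by : ∀ e → St w e s → CritM w e (lab t)
      by nothing  _ = ≺⇒crit⊥ (TR-≺ t v r)
      by (just D) y = cone-crit h s (valid-par t v eq) y (lab t)
                        (transport (λ u → labM u ≺ lab t) eq (child-≺ t v))

    next-crit : ∀ w d {Γ} → CritM w d Γ → CritM w d (next d Γ)
    next-crit w nothing  c = ≺⇒crit⊥ (≺-° (crit⇒≺ c))
    next-crit w (just D) {Γ} c with em {P = HasJ5 L}
    ... | no _  = c
    ... | yes h with °-cases Γ
    ...   | inj₁ eq = transport (Crit (labM w °) D) (sym eq) c
    ...   | inj₂ s  = crit-persist (axJ5-thm h) c s

    next-∋ : ∀ d {Γ A} → A ∈ Φ → Γ ∋ A → next d Γ ∋ A
    next-∋ d {Γ} m a with pick-cases d
    ... | inj₁ eq           = transport (_∋ _) (sym (eq Γ (Γ °))) (°⁺ m a)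
    ... | inj₂ (_ , _ , eq) = transport (_∋ _) (sym (eq Γ (Γ °))) a

    serve : ∀ w d {s B C} → CritM w d s → (B ▷ C) ∈ Φ → labM w ∋ B ▷ C → s ∋ B →
            Σ MCS λ Δ → CritM w d Δ × (Δ ∋ C) × (s ⊑ Δ)
    serve w nothing  c m bc b = crit-next-M am c b bc
    serve w (just D) c m bc b = crit-next-M am c b (°⁺ m bc)

    -- birth grows strictly (⊏) along R and does not shrink (⊑) along S, which makes R well-founded.
    birth : Tree → MCS
    birth (new w _ _)   = labM w °
    birth (jmp w d t _) = pick d (labM w °) (birth t)

    birth-⊏ : ∀ t → Valid t → birth t ⊏ lab t °
    birth-⊏ (new _ _ _) (_ , c) = ≺⇒⊏° (crit⇒≺ c)
    birth-⊏ (jmp w d t Δ) (_ , v , _ , _ , c , b) with pick-cases d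
    ... | inj₂ (_ , (D , refl) , eq) =
      transport (_⊏ Δ °) (sym (eq _ _)) (≺⇒⊏° (crit⇒≺ c))
    ... | inj₁ eq = transport (_⊏ Δ °) (sym (eq _ _)) (⊏-⊑ (birth-⊏ t v)
      (⊑-trans (transport (_⊑ Δ) (eq _ _) b) (°-⊑ Δ)))

    -- Without J5 a direction is forgotten after one further R-step, so a source in direction `D`
    -- above `w` is a child of `w`, and its birth is already `labM w °`.
    birth-jmp : ∀ {w d t Δ} → Valid (jmp w d t Δ) → birth t ⊑ birth (jmp w d t Δ)
    birth-jmp {w} {d} {t} (_ , v , r , x , _) with pick-cases d
    ... | inj₁ eq = transport (birth t ⊑_) (sym (eq _ _)) ⊑-refl
    ... | inj₂ (n , (D , refl) , eq) =
      transport (birth t ⊑_) (sym (eq _ _)) (transport (_⊑ labM w °) (sym (same t v r x)) ⊑-refl)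
      where
      same : ∀ t → Valid t → TR w t → St w (just D) t → birth t ≡ labM w °
      same (new _ _ _) v (inj₁ refl) x = refl
      same t@(jmp _ _ _ _) v (inj₁ refl) x with unique t v (st-here t refl) x
      ... | refl = eq _ _
      same t v (inj₂ (s , e , d′ , y)) x with trans (unique t v x (st-base t e y refl)) (up-noJ5 n d′)
      ... | ()

    mutual
      birth-child : ∀ {s} t → Valid t → par t ≡ just s → birth s ⊏ birth t
      birth-child (new (just s) _ _) (v , _) refl = birth-⊏ s v
      birth-child {s} (jmp _ d t _) (v , v′ , r , _) refl with pick-cases d
      ... | inj₁ eq           = transport (birth s ⊏_) (sym (eq _ _)) (birth-TR t v′ r)
      ... | inj₂ (_ , _ , eq) = transport (birth s ⊏_) (sym (eq _ _)) (birth-⊏ s v)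

      birth-TR : ∀ {s} t → Valid t → TR (just s) t → birth s ⊏ birth t
      birth-TR t v (inj₁ eq) = birth-child t v eq
      birth-TR t@(new (just u) _ _) v (inj₂ (u , refl , _ , x)) =
        ⊑-⊏ (birth-St u (proj₁ v) x) (birth-child t v refl)
      birth-TR t@(jmp (just u) _ _ _) v (inj₂ (u , refl , _ , x)) =
        ⊑-⊏ (birth-St u (proj₁ v) x) (birth-child t v refl)

      birth-St : ∀ {s d} t → Valid t → St (just s) d t → birth s ⊑ birth t
      birth-St t v new-here = proj₁ (birth-child t v refl)
      birth-St t v jmp-here = proj₁ (birth-child t v refl)
      birth-St t@(new (just u) _ _) v (new-base x _) =
        ⊑-trans (birth-St u (proj₁ v) x) (proj₁ (birth-child t v refl))
      birth-St t@(jmp (just u) _ _ _) v (jmp-base x _) =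
        ⊑-trans (birth-St u (proj₁ v) x) (proj₁ (birth-child t v refl))
      birth-St (jmp _ _ t _) v (start refl) = birth-jmp v
      birth-St (jmp _ _ t _) v (src x) = ⊑-trans (birth-St t (proj₁ (proj₂ v)) x) (birth-jmp v)

    Point : Set
    Point = Σ Tree Valid

    data Jump : Tree → Tree → Set where
      jump : ∀ {w d t Δ} → Jump t (jmp w d t Δ)

    UR US : Point → Point → Set
    UR x y = TR (just (proj₁ x)) (proj₁ y)
    US x y = Jump (proj₁ x) (proj₁ y) ⊎ (HasJ5 L × UR x y)

    UR-trans : ∀ {x y z} → UR x y → UR y z → UR x z
    UR-trans {y = y , _} {z} r = St-TR-TR (proj₁ z) (proj₂ (TR-St y r))

    US-UR : ∀ {x y z} → US x y → UR y z → UR x z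
    US-UR {x , _} {jmp w d .x Δ , _} {z} (inj₁ jump) r = St-TR-TR (proj₁ z) (start {v = w} {d = d} {Δ = Δ} refl) r
    US-UR {x} {y} {z} (inj₂ (_ , r′)) r = UR-trans {x} {y} {z} r′ r

    UR-wf : WellFounded (λ y x → UR x y)
    UR-wf = Subrelation.wellFounded (λ {y} r → birth-TR (proj₁ y) (proj₂ y) r)
              (On.wellFounded (λ x → birth (proj₁ x)) ⊏-wf)

    uframe : Frame
    uframe = record
      { P = Point ; R = UR ; S = US
      ; R-trans = λ {x} {y} {z} → UR-trans {x} {y} {z} ; R-wf = UR-wf
      ; cond-J5 = λ h r → inj₂ (h , r)
      ; cond-M  = λ _ {x} {y} {z} → US-UR {x} {y} {z}
      ; cond-P  = λ h → ⊥-elim (noP h)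
      ; cond-W₀ = λ h → ⊥-elim (noW h)
      ; cond-W  = λ h → ⊥-elim (noW h) }

    label : Point → MCS
    label x = lab (proj₁ x)

    module _ (w : Maybe Tree) (vw : ValidM w) (vis : Point → Set)
      (out : ∀ x → vis x → TR w (proj₁ x)) (into : ∀ x → TR w (proj₁ x) → vis x) where

      box : ∀ A → (□ A) ∈ Φ → labM w ∌ □ A → Σ Point λ y → vis y × (label y ∌ A)
      box A m n =
        let Δ , s , na = □-exists (labM w °) A (°⁻ m n)
            x = new w ⊥' Δ , vw , ≺⇒crit⊥ s
        in x , into x (inj₁ refl) , na

      arrow⁺ : ∀ A B → (A ▷ B) ∈ Φ → labM w ∋ A ▷ B → ∀ U → Closed US U →
               ∀ y → vis y → U y → label y ∋ A → Σ Point λ z → vis z × U z × (label z ∋ B)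
      arrow⁺ A B m ab U c (t , v) vt Ut a = from (TR-St t (out (t , v) vt))
        where
        from : Σ (Maybe Fm) (λ d → St w d t) → Σ Point λ z → vis z × U z × (label z ∋ B)
        from (d₁ , st) =
          let Δ , cΔ , b , s = serve w d₁ (next-crit w d₁ (critical t v (out (t , v) vt) st)) m ab
                                 (next-∋ d₁ (antecedent m) a)
              x = jmp w d₁ t Δ , vw , v , out (t , v) vt , st , cΔ , s
          in x , into x (inj₁ refl) , c (inj₁ jump) Ut , b

      cone-closed : ∀ D → Closed US (λ z → St w (just D) (proj₁ z))
      cone-closed D {y , _} {z , _} (inj₁ s) u = along s
        where along : Jump y z → St w (just D) z
              along jump = src u
      cone-closed D {y} {z} (inj₂ (h , r)) u =
        transport (λ d → St w d (proj₁ z)) (up-J5 h (just D)) (St-TR u r)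

      arrow⁻ : ∀ A B → (A ▷ B) ∈ Φ → labM w ∌ A ▷ B → Σ (Point → Set) λ U → Closed US U ×
               (Σ Point λ y → vis y × U y × (label y ∋ A)) × (∀ z → vis z → U z → label z ∌ B)
      arrow⁻ A B m n =
        let Δ , c , a = crit-exists (labM w °) B A (°⁻ m n)
            x = new w B Δ , vw , c
        in (λ z → St w (just B) (proj₁ z)) , (λ {y} {z} → cone-closed B {y} {z}) ,
           (x , into x (inj₁ refl) , new-here , a) ,
           λ z vz u → crit-self (critical (proj₁ z) (proj₂ z) (out z vz) u)

      truthful : Truthful Φ (labM w) uframe label vis
      truthful = record { □⁻ = box ; ▷⁺ = arrow⁺ ; ▷⁻ = arrow⁻ }

    unravelled : Model Φ Γ₀
    unravelled = record
      { frame  = uframe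
      ; lab    = label
      ; root-≺ = λ x → TR-≺ (proj₁ x) (proj₂ x) (TR-root (proj₁ x))
      ; R-≺    = λ {x} {y} r → TR-≺ (proj₁ y) (proj₂ y) r
      ; truth₀ = truthful nothing tt (λ _ → ⊤) (λ x _ → TR-root (proj₁ x)) (λ _ _ → tt)
      ; truth  = λ x → truthful (just (proj₁ x)) (proj₂ x) (UR x) (λ _ r → r) (λ _ r → r) }

  -- Spaces given by bases N k x (k ∈ K) of punctured neighbourhoods of x, which form the Kripke
  -- successors of x when N k does not depend on k.

  ∧-split : ∀ {a b} → a ∧ b ≡ true → (a ≡ true) × (b ≡ true)
  ∧-split {true} eq = refl , eq

  ∧-join : ∀ {a b} → a ≡ true → b ≡ true → a ∧ b ≡ true
  ∧-join refl eq = eq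

  module Space {X K : Set} (N : K → X → X → Set) (S : X → X → Set) (k₀ : K)
    (meet : ∀ k k′ → Σ K λ k″ → ∀ {x y} → N k″ x y → N k x y × N k′ x y)
    (N-trans : ∀ {k k′ x y z} → N k x y → N k′ y z → N k x z)
    (N-wf : WellFounded (λ y x → Σ K λ k → N k x y))
    where

    near : Topology X
    near = record
      { isOpen = λ U → ∀ x → U x ≡ true → Σ K λ k → ∀ y → N k x y → U y ≡ true
      ; resp   = λ U V eq o x Vx → let k , f = o x (trans (eq x) Vx) in k , λ y n → trans (sym (eq y)) (f y n)
      ; empty  = λ _ ()
      ; full   = λ _ _ → k₀ , λ _ _ → refl
      ; inter  = λ U V o o′ x UVx →
          let Ux , Vx = ∧-split {U x} UVx
              k , f   = o x Ux
              k′ , f′ = o′ x Vx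
              k″ , g  = meet k k′
          in k″ , λ y n → ∧-join (f y (proj₁ (g n))) (f′ y (proj₂ (g n)))
      ; union  = λ 𝒰 o W eq x Wx →
          let U , u , Ux = Equivalence.to (eq x) Wx
              k , f      = o U u x Ux
          in k , λ y n → Equivalence.from (eq y) (U , u , f y n) }

    closing : Topology X
    closing = record
      { isOpen = λ U → Closed S (λ x → U x ≡ true)
      ; resp   = λ U V eq o s Vx → trans (sym (eq _)) (o s (trans (eq _) Vx))
      ; empty  = λ _ ()
      ; full   = λ _ _ → refl
      ; inter  = λ U V o o′ {x} s UVx →
          let Ux , Vx = ∧-split {U x} UVx in ∧-join (o s Ux) (o′ s Vx)
      ; union  = λ 𝒰 o W eq s Wx →
          let U , u , Ux = Equivalence.to (eq _) Wx in Equivalence.from (eq _) (U , u , o U u s Ux) }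

    N-irrefl : ∀ {k x} → ¬ N k x x
    N-irrefl {k} {x} = go (N-wf x)
      where go : ∀ {x} → Acc (λ y x → Σ K λ k → N k x y) x → ¬ N k x x
            go (acc rs) n = go (rs (k , n)) n

    Often : (X → Set) → X → Set
    Often Y x = ∀ k → Σ X λ y → N k x y × Y y

    Eventually : (X → Set) → X → Set
    Eventually Y x = Σ K λ k → ∀ y → N k x y → Y y

    Often-map : ∀ {Y Z : X → Set} {x} → (∀ y → Y y → Z y) → Often Y x → Often Z x
    Often-map f o k = let y , n , Yy = o k in y , n , f y Yy

    d⇒Often : ∀ {Y x} → d near Y x → Often Y x
    d⇒Often {Y} {x} dY k = from (dY U U-open (χ⁺ (inj₁ refl)))
      where
      U : X → Bool
      U y = χ ((y ≡ x) ⊎ N k x y)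
      spread : ∀ {y} → (y ≡ x) ⊎ N k x y → Σ K λ k′ → ∀ z → N k′ y z → U z ≡ true
      spread (inj₁ refl) = k , λ z n → χ⁺ (inj₂ n)
      spread (inj₂ n)    = k , λ z n′ → χ⁺ (inj₂ (N-trans n n′))
      U-open : isOpen near U
      U-open y Uy = spread (χ⁻ Uy)
      from : (Σ X λ y → Y y × ¬ (y ≡ x) × (U y ≡ true)) → Σ X λ y → N k x y × Y y
      from (y , Yy , y≢x , Uy) with χ⁻ Uy
      ... | inj₁ eq = ⊥-elim (y≢x eq)
      ... | inj₂ n  = y , n , Yy

    Often⇒d : ∀ {Y x} → Often Y x → d near Y x
    Often⇒d o U U-open Ux =
      let k , f      = U-open _ Ux
          y , n , Yy = o k
      in y , Yy , (λ eq → N-irrefl (transport (N k _) eq n)) , f y n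

    cd⇒Eventually : ∀ {Y x} → cd near Y x → Eventually Y x
    cd⇒Eventually {Y} {x} c = ¬¬-elim λ none → c (Often⇒d λ k → ¬¬-elim λ no →
      none (k , λ y n → ¬¬-elim λ nY → no (y , n , nY)))

    Eventually⇒cd : ∀ {Y x} → Eventually Y x → cd near Y x
    Eventually⇒cd (k , f) dY = let y , n , nY = d⇒Often dY k in nY (f y n)

    ¬cd¬⇒Often : ∀ {Y x} → ¬ cd near (λ y → ¬ Y y) x → Often Y x
    ¬cd¬⇒Often {Y} n k = ¬¬-elim λ no → n (Eventually⇒cd (k , λ y m Yy → no (y , m , Yy)))

    Serves : (X → Set) → (X → Set) → X → Set₁
    Serves Y Z x = ∀ U → Closed S U → Often (λ y → Y y × U y) x → Often (λ z → Z z × U z) x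

    e⇒Serves : ∀ {Y Z x} → e near closing Y Z x → Serves Y Z x
    e⇒Serves h U c o =
      Often-map (λ _ (z , u) → z , χ⁻ u)
        (d⇒Often (h (λ y → χ (U y)) (λ s u → χ⁺ (c s (χ⁻ u)))
          (Often⇒d (Often-map (λ _ (y , u) → y , χ⁺ u) o))))

    Serves⇒e : ∀ {Y Z x} → Serves Y Z x → e near closing Y Z x
    Serves⇒e h U c o = Often⇒d (h _ c (d⇒Often o))

    -- Soundness of the axioms in such spaces

    module Soundness
      (cJ5 : HasJ5 L → ∀ {k k′ x y z} → N k x y → N k′ y z → S y z)
      (cM : HasM L → ∀ {k x y z} → S x y → N k y z → N k x z)
      (cP : HasP L → ∀ {k x y z} → N k x y → S y z → N k x z)
      (cW : HasW L → ∀ x k (Y : X → Set) y → N k x y → Y y → Σ X λ y′ → N k x y′ × Y y′ ×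
            Σ (X → Set) λ U → Closed S U × U y′ ×
            (∀ {k′ k″ z t} → N k′ x z → U z → N k″ z t → ¬ Y t))
      where

      Val : Set₁
      Val = ℕ → X → Set

      ⟪_⟫ : Fm → Val → X → Set
      ⟪ φ ⟫ V = ⟦ φ ⟧ near closing V

      sub-sem : ∀ σ φ V → ⟪ sub σ φ ⟫ V ≡ ⟪ φ ⟫ (λ n → ⟪ σ n ⟫ V)
      sub-sem σ (var n)  V = refl
      sub-sem σ ⊤'       V = refl
      sub-sem σ ⊥'       V = refl
      sub-sem σ (¬' φ)   V = cong (λ Y x → ¬ Y x) (sub-sem σ φ V)
      sub-sem σ (φ ∧' ψ) V = cong₂ (λ Y Z x → Y x × Z x) (sub-sem σ φ V) (sub-sem σ ψ V)
      sub-sem σ (φ ∨' ψ) V = cong₂ (λ Y Z x → Y x ⊎ Z x) (sub-sem σ φ V) (sub-sem σ ψ V)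
      sub-sem σ (φ ⇒ ψ)  V = cong₂ (λ Y Z x → Y x → Z x) (sub-sem σ φ V) (sub-sem σ ψ V)
      sub-sem σ (□ φ)    V = cong (cd near) (sub-sem σ φ V)
      sub-sem σ (φ ▷ ψ)  V = cong₂ (e near closing) (sub-sem σ φ V) (sub-sem σ ψ V)

      module _ (V : Val) (x : X) where

        bits : ℕ → Bool
        bits n = χ (V n x)

        mutual
          bev⁺ : ∀ {φ} → Propositional φ → ⟪ φ ⟫ V x → bev bits φ ≡ true
          bev⁺ (pvar n) h = χ⁺ h
          bev⁺ ptop h = refl
          bev⁺ (pneg {φ} a) h with bev bits φ | bev⁻ a
          ... | true  | f = ⊥-elim (h (f refl))
          ... | false | _ = refl
          bev⁺ (pand a b) (h , h′) = ∧-join (bev⁺ a h) (bev⁺ b h′)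
          bev⁺ (por a b) (inj₁ h) rewrite bev⁺ a h = refl
          bev⁺ (por {φ} a b) (inj₂ h) rewrite bev⁺ b h with bev bits φ
          ... | true  = refl
          ... | false = refl
          bev⁺ (pimp {φ} a b) h with bev bits φ | bev⁻ a
          ... | true  | f = bev⁺ b (h (f refl))
          ... | false | _ = refl

          bev⁻ : ∀ {φ} → Propositional φ → bev bits φ ≡ true → ⟪ φ ⟫ V x
          bev⁻ (pvar n) eq = χ⁻ eq
          bev⁻ ptop eq = tt
          bev⁻ (pneg {φ} a) eq h with bev bits φ | bev⁺ a h
          bev⁻ (pneg {φ} a) () h | true | refl
          bev⁻ (pand {φ} a b) eq = let u , v = ∧-split {bev bits φ} eq in bev⁻ a u , bev⁻ b v
          bev⁻ (por {φ} a b) eq with bev bits φ | bev⁻ a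
          ... | true  | f = inj₁ (f refl)
          ... | false | _ = inj₂ (bev⁻ b eq)
          bev⁻ (pimp {φ} a b) eq h with bev bits φ | bev⁺ a h
          ... | true | refl = bev⁻ b eq

      module _ (V : Val) where

        private
          P Q R : X → Set
          P = V 0
          Q = V 1
          R = V 2

        sound-K : ∀ x → ⟪ axK ⟫ V x
        sound-K x f a =
          let k , F  = cd⇒Eventually f
              k′ , A = cd⇒Eventually a
              k″ , g = meet k k′
          in Eventually⇒cd (k″ , λ y n → F y (proj₁ (g n)) (A y (proj₂ (g n))))

        sound-L : ∀ x → ⟪ axL ⟫ V x
        sound-L x f = Eventually⇒cd (k , λ y → go (N-wf y))
          where
          k : K
          k = proj₁ (cd⇒Eventually f)
          F : ∀ y → N k x y → cd near P y → P y
          F = proj₂ (cd⇒Eventually f)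
          go : ∀ {y} → Acc (λ y x → Σ K λ k → N k x y) y → N k x y → P y
          go (acc rs) n = F _ n (Eventually⇒cd (k₀ , λ z n′ → go (rs (k₀ , n′)) (N-trans n n′)))

        sound-J1 : ∀ x → ⟪ axJ1 ⟫ V x
        sound-J1 x f = Serves⇒e λ U c o k →
          let k₁ , F = cd⇒Eventually f
              k₂ , g = meet k k₁
              y , n , Py , Uy = o k₂
          in y , proj₁ (g n) , F y (proj₂ (g n)) Py , Uy

        sound-J2 : ∀ x → ⟪ axJ2 ⟫ V x
        sound-J2 x (f , g) = Serves⇒e λ U c o → e⇒Serves g U c (e⇒Serves f U c o)

        sound-J3 : ∀ x → ⟪ axJ3 ⟫ V x
        sound-J3 x (f , g) = Serves⇒e λ U c o → by U c o em
          where
          by : ∀ U → Closed S U → Often (λ y → (P y ⊎ Q y) × U y) x →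
               Dec (Often (λ y → P y × U y) x) → Often (λ y → R y × U y) x
          by U c o (yes oP) = e⇒Serves f U c oP
          by U c o (no nP) = e⇒Serves g U c λ k → ¬¬-elim λ nQ → nP λ k′ →
            let k″ , h = meet k k′
                y , n , PQ , Uy = o k″
            in y , proj₂ (h n) , [ (λ Py → Py) , (λ Qy → ⊥-elim (nQ (y , proj₁ (h n) , Qy , Uy))) ]′ PQ , Uy

        sound-J4 : ∀ x → ⟪ axJ4 ⟫ V x
        sound-J4 x f dP cQ =
          let k , F = cd⇒Eventually cQ
              z , n , Qz , _ = e⇒Serves f (λ _ → ⊤) (λ _ _ → tt) (Often-map (λ _ Py → Py , tt) (¬cd¬⇒Often dP)) k
          in F z n Qz

        sound-J5 : HasJ5 L → ∀ x → ⟪ axJ5 ⟫ V x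
        sound-J5 h x = Serves⇒e λ U c o k →
          let y , n , dP , Uy = o k
              z , n′ , Pz     = ¬cd¬⇒Often dP k₀
          in z , N-trans n n′ , Pz , c (cJ5 h n n′) Uy

        -- By `cM` the truth set of `□ r` is S-closed, so `U` may be intersected with it.
        sound-M : HasM L → ∀ x → ⟪ axM ⟫ V x
        sound-M h x f = Serves⇒e λ U c o → Often-map (λ _ (Qy , Uy , Ry) → (Qy , Ry) , Uy)
          (e⇒Serves f (λ y → U y × cd near R y)
            (λ s (Uy , Ry) → c s Uy , let k , F = cd⇒Eventually Ry in
              Eventually⇒cd (k , λ t n → F t (cM h s n)))
            (Often-map (λ _ ((Py , Ry) , Uy) → Py , Uy , Ry) o))

        sound-P : HasP L → ∀ x → ⟪ axP ⟫ V x
        sound-P h x f = Eventually⇒cd (¬¬-elim λ none → contradictory λ k → ¬¬-elim λ no →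
            none (k , λ y n → ¬¬-elim λ nPQ → no (y , n , nPQ)))
          where
          -- U collects, near each y that refutes P ▷ Q, an open set refuting it.
          U : X → Set
          U z = Σ X λ y → Σ (X → Bool) λ W → Σ K λ k → Closed S (λ t → W t ≡ true) ×
                (∀ t → N k y t → Q t → ¬ (W t ≡ true)) × N k y z × (W z ≡ true)
          U-closed : Closed S U
          U-closed s (y , W , k , c , a , n , w) = y , W , k , c , a , cP h n s , c s w
          contradictory : Often (λ y → ¬ e near closing P Q y) x → ⊥
          contradictory o =
            let z , _ , Qz , y , W , k , c , a , n , w = e⇒Serves f U U-closed hits k₀
            in a z n Qz w
            where
            hits : Often (λ z → P z × U z) x
            hits k = ¬¬-elim λ no →
              let y , n , nPQ = o k
              in nPQ λ W W-open dP → Often⇒d λ k′ → ¬¬-elim λ no′ →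
                   let z , n′ , Pz , w = d⇒Often dP k′
                   in no (z , N-trans n n′ , Pz , y , W , k′ , (λ {_} {_} s → W-open s)
                         , (λ t m Qt Wt → no′ (t , m , Qt , Wt)) , n′ , w)

        -- `Bounded U` is the part of `U` covered by S-closed sets from which no step out of a point
        -- near `x` leads to `P` within `U`. By `cW` it still meets `P` often, and its points of `Q`
        -- near `x` satisfy `□ (¬' p)`, since J5 keeps their successors in `U`.
        sound-W : HasW L → ∀ x → ⟪ axW ⟫ V x
        sound-W h x f = Serves⇒e λ U c o k →
          let z , n , Qz , W , _ , w , u , a = e⇒Serves f (Bounded U) (bounded-closed U c) (hits U o) k
          in z , n , (Qz , Eventually⇒cd (k₀ , λ t m Pt →
               a n w m (Pt , c (cJ5 (HasW⇒HasJ5 L h) n m) u))) , u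
          where
          module _ (U : X → Set) where
            Bounded : X → Set
            Bounded z = Σ (X → Bool) λ W → Closed S (λ t → W t ≡ true) × (W z ≡ true) × U z ×
              (∀ {k′ k″ s t} → N k′ x s → W s ≡ true → N k″ s t → ¬ (P t × U t))
            bounded-closed : Closed S U → Closed S Bounded
            bounded-closed c s (W , c′ , w , u , a) = W , c′ , c′ s w , c s u , a
            hits : Often (λ y → P y × U y) x → Often (λ z → P z × Bounded z) x
            hits o k =
              let y , n , PU = o k
                  y′ , n′ , (Py′ , Uy′) , W , c′ , w , a = cW h x k (λ t → P t × U t) y n PU
              in y′ , n′ , Py′ , (λ t → χ (W t)) , (λ s w → χ⁺ (c′ s (χ⁻ w))) , χ⁺ w , Uy′
                 , λ m w → a m (χ⁻ w)

      sound : ∀ φ → Thm L φ → ∀ V x → ⟪ φ ⟫ V x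
      sound φ (taut (a , v)) V x = bev⁻ V x a (v (bits V x))
      sound _ ak  V = sound-K V
      sound _ al  V = sound-L V
      sound _ aj1 V = sound-J1 V
      sound _ aj2 V = sound-J2 V
      sound _ aj3 V = sound-J3 V
      sound _ aj4 V = sound-J4 V
      sound φ (extra x) V with extra-schema L x
      ... | inj₁ (h , refl)               = sound-J5 V h
      ... | inj₂ (inj₁ (h , refl))        = sound-M V h
      ... | inj₂ (inj₂ (inj₁ (h , refl))) = sound-P V h
      ... | inj₂ (inj₂ (inj₂ (h , refl))) = sound-W V h
      sound φ (mp {φ = ψ} f a) V x = sound (ψ ⇒ φ) f V x (sound ψ a V x)
      sound _ (nec {φ} t) V x = Eventually⇒cd (k₀ , λ y _ → sound φ t V y)
      sound _ (subst {φ} σ t) V x = transport (λ Y → Y x) (sym (sub-sem σ φ V)) (sound φ t _ x)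

  -- Subformula closure

  sf : Fm → List Fm
  sf′ : Fm → List Fm
  sf A = A ∷ sf′ A
  sf′ (var _)  = []
  sf′ ⊤'       = []
  sf′ ⊥'       = []
  sf′ (¬' A)   = sf A
  sf′ (A ∧' B) = sf A ++ sf B
  sf′ (A ∨' B) = sf A ++ sf B
  sf′ (A ⇒ B)  = sf A ++ sf B
  sf′ (□ A)    = sf A
  sf′ (A ▷ B)  = sf A ++ sf B

  mutual
    sf-trans : ∀ A {B C} → B ∈ sf A → C ∈ sf B → C ∈ sf A
    sf-trans A (here refl) c = c
    sf-trans A (there b)   c = there (sf′-trans A b c)

    sf′-trans : ∀ A {B C} → B ∈ sf′ A → C ∈ sf B → C ∈ sf′ A
    sf′-trans (¬' A)   b c = sf-trans A b c
    sf′-trans (A ∧' B) b c = sf-trans-++ A B b c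
    sf′-trans (A ∨' B) b c = sf-trans-++ A B b c
    sf′-trans (A ⇒ B)  b c = sf-trans-++ A B b c
    sf′-trans (□ A)    b c = sf-trans A b c
    sf′-trans (A ▷ B)  b c = sf-trans-++ A B b c

    sf-trans-++ : ∀ A B {C D} → C ∈ sf A ++ sf B → D ∈ sf C → D ∈ sf A ++ sf B
    sf-trans-++ A B m c with ∈-++⁻ (sf A) m
    ... | inj₁ a = ∈-++⁺ˡ (sf-trans A a c)
    ... | inj₂ b = ∈-++⁺ʳ (sf A) (sf-trans B b c)

  sfs : List Fm → List Fm
  sfs []      = []
  sfs (A ∷ l) = sf A ++ sfs l

  sfs-self : ∀ {A} l → A ∈ l → A ∈ sfs l
  sfs-self (A ∷ l) (here refl) = here refl
  sfs-self (A ∷ l) (there m)   = ∈-++⁺ʳ (sf A) (sfs-self l m)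

  sfs-closed : ∀ {A B} l → A ∈ sfs l → B ∈ sf A → B ∈ sfs l
  sfs-closed (C ∷ l) m b with ∈-++⁻ (sf C) m
  ... | inj₁ a = ∈-++⁺ˡ (sf-trans C a b)
  ... | inj₂ a = ∈-++⁺ʳ (sf C) (sfs-closed l a b)

  antecedent-closed : ∀ l {A B} → (A ▷ B) ∈ sfs l → A ∈ sfs l
  antecedent-closed l m = sfs-closed l m (there (here refl))

  -- The limit space
  module Limit (Γ : MCS) (model : ∀ l → Model (sfs l) Γ) where

    module M (l : List Fm) = Model (model l)

    Pt : Set
    Pt = Maybe (Σ (List Fm) M.P)

    -- Taking only indices `l` that include `k` makes the truth lemma of frame `l` available for
    -- every member of `k`.
    data Near (k : List Fm) : Pt → Pt → Set where
      top   : ∀ {l y} → (∀ {A} → A ∈ k → A ∈ l) → Near k nothing (just (l , y))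
      inner : ∀ {l x y} → M.R l x y → Near k (just (l , x)) (just (l , y))

    data Link : Pt → Pt → Set where
      inner : ∀ {l x y} → M.S l x y → Link (just (l , x)) (just (l , y))

    data Inside (l : List Fm) (U : M.P l → Set) : Pt → Set where
      inside : ∀ {y} → U y → Inside l U (just (l , y))

    inside-closed : ∀ {l U} → Closed (M.S l) U → Closed Link (Inside l U)
    inside-closed c (inner s) (inside u) = inside (c s u)

    meet : ∀ k k′ → Σ (List Fm) λ k″ → ∀ {x y} → Near k″ x y → Near k x y × Near k′ x y
    meet k k′ = k ++ k′ , λ { (top s) → top (λ m → s (∈-++⁺ˡ m)) , top (λ m → s (∈-++⁺ʳ k m))
                            ; (inner s) → inner s , inner s }

    Near-trans : ∀ {k k′ x y z} → Near k x y → Near k′ y z → Near k x z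
    Near-trans (top s)   (inner _)  = top s
    Near-trans (inner {l} s) (inner t) = inner (M.R-trans l s t)

    inner-acc : ∀ l {y} → Acc (λ y x → M.R l x y) y →
                Acc (λ y x → Σ (List Fm) λ k → Near k x y) (just (l , y))
    inner-acc l (acc rs) = acc λ { (_ , inner s) → inner-acc l (rs s) }

    Near-wf : WellFounded (λ y x → Σ (List Fm) λ k → Near k x y)
    Near-wf nothing        = acc λ { (_ , top {l} _) → inner-acc l (M.R-wf l _) }
    Near-wf (just (l , y)) = inner-acc l (M.R-wf l y)

    open Space Near Link [] meet Near-trans Near-wf

    limit-W : HasW L → ∀ x k (Y : Pt → Set) y → Near k x y → Y y → Σ Pt λ y′ → Near k x y′ × Y y′ ×
      Σ (Pt → Set) λ U → Closed Link U × U y′ × (∀ {k′ k″ z t} → Near k′ x z → U z → Near k″ z t → ¬ Y t)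
    limit-W h nothing k Y (just (l , y)) (top s) Yy =
      let y′ , _ , Yy′ , U , c , Uy′ , a = M.cond-W₀ l h (λ y → Y (just (l , y))) y tt Yy
      in just (l , y′) , top s , Yy′ , Inside l U , inside-closed c , inside Uy′ ,
         λ { _ (inside u) (inner t) → a _ tt u _ t }
    limit-W h (just (l , x)) k Y (just (l , y)) (inner s) Yy =
      let y′ , s′ , Yy′ , U , c , Uy′ , a = M.cond-W l h x (λ y → Y (just (l , y))) y s Yy
      in just (l , y′) , inner s′ , Yy′ , Inside l U , inside-closed c , inside Uy′ ,
         λ { (inner v) (inside u) (inner t) → a _ v u _ t }

    limit-J5 : HasJ5 L → ∀ {k k′ x y z} → Near k x y → Near k′ y z → Link y z
    limit-J5 h (top _)   (inner {l} s) = inner (M.cond-J5 l h s)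
    limit-J5 h (inner _) (inner {l} s) = inner (M.cond-J5 l h s)

    limit-M : HasM L → ∀ {k x y z} → Link x y → Near k y z → Near k x z
    limit-M h (inner {l} s) (inner t) = inner (M.cond-M l h s t)

    limit-P : HasP L → ∀ {k x y z} → Near k x y → Link y z → Near k x z
    limit-P h (top s)       (inner _) = top s
    limit-P h (inner {l} s) (inner t) = inner (M.cond-P l h s t)

    open Soundness limit-J5 limit-M limit-P limit-W

    space : BiSpace
    space = record { X = Pt ; pt = nothing ; τ0 = near ; τ1 = closing }

    space-L : IsLSpace L space
    space-L φ t V x = sound φ t V x

    V₀ : ℕ → Pt → Set
    V₀ n nothing        = Γ ∋ var n
    V₀ n (just (l , y)) = M.lab l y ∋ var n

    T : Fm → Pt → Set
    T A = ⟪ A ⟫ V₀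

    module _ (l : List Fm) where

      ⊆¹ : ∀ {A} B → B ∈ sf′ A → A ∈ sfs l → B ∈ sfs l
      ⊆¹ B b m = sfs-closed l m (there b)

      right : ∀ A B → B ∈ sf A ++ sf B
      right A B = ∈-++⁺ʳ (sf A) (here refl)

      mutual
        truth⁺ : ∀ A → A ∈ sfs l → ∀ y → M.lab l y ∋ A → T A (just (l , y))
        truth⁺ (var n) m y a = a
        truth⁺ ⊤' m y a = tt
        truth⁺ ⊥' m y a = ∋-⊥ a
        truth⁺ (¬' A) m y na t = ∋-¬⁻ na (truth⁻ A (⊆¹ A (here refl) m) y t)
        truth⁺ (A ∧' B) m y ab = truth⁺ A (⊆¹ A (here refl) m) y (∋-∧ˡ ab)
                               , truth⁺ B (⊆¹ B (right A B) m) y (∋-∧ʳ ab)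
        truth⁺ (A ∨' B) m y ab with ∋-∨⁻ ab
        ... | inj₁ a = inj₁ (truth⁺ A (⊆¹ A (here refl) m) y a)
        ... | inj₂ b = inj₂ (truth⁺ B (⊆¹ B (right A B) m) y b)
        truth⁺ (A ⇒ B) m y ab t =
          truth⁺ B (⊆¹ B (right A B) m) y (∋-app ab (truth⁻ A (⊆¹ A (here refl) m) y t))
        truth⁺ (□ A) m y a = Eventually⇒cd ([] ,
          λ { _ (inner s) → truth⁺ A (⊆¹ A (here refl) m) _ (proj₁ (M.R-≺ l s A a)) })
        truth⁺ (A ▷ B) m y ab = Serves⇒e λ U c o → served U c (o [])
          where
          served : ∀ U → Closed Link U → (Σ Pt λ x → Near [] (just (l , y)) x × T A x × U x) →
                   Often (λ z → T B z × U z) (just (l , y))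
          served U c (just (l , x) , inner s , a , u) k =
            let z , s′ , Uz , b = Truthful.▷⁺ (M.truth l y) A B m ab (λ z → U (just (l , z)))
                                    (λ t → c (inner t)) x s u (truth⁻ A (⊆¹ A (here refl) m) x a)
            in just (l , z) , inner s′ , truth⁺ B (⊆¹ B (right A B) m) z b , Uz

        truth⁻ : ∀ A → A ∈ sfs l → ∀ y → T A (just (l , y)) → M.lab l y ∋ A
        truth⁻ (var n) m y t = t
        truth⁻ ⊤' m y t = ∋-thm ⊤-intro
        truth⁻ (¬' A) m y t = ∋-¬⁺ λ a → t (truth⁺ A (⊆¹ A (here refl) m) y a)
        truth⁻ (A ∧' B) m y (t , u) = ∋-∧⁺ (truth⁻ A (⊆¹ A (here refl) m) y t)
                                           (truth⁻ B (⊆¹ B (right A B) m) y u)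
        truth⁻ (A ∨' B) m y (inj₁ t) = ∋-∨ˡ (truth⁻ A (⊆¹ A (here refl) m) y t)
        truth⁻ (A ∨' B) m y (inj₂ t) = ∋-∨ʳ (truth⁻ B (⊆¹ B (right A B) m) y t)
        truth⁻ (A ⇒ B) m y f = ∋-⇒⁺ λ a →
          truth⁻ B (⊆¹ B (right A B) m) y (f (truth⁺ A (⊆¹ A (here refl) m) y a))
        truth⁻ (□ A) m y t = ¬¬-elim λ n →
          let z , s , na = Truthful.□⁻ (M.truth l y) A m n
              _ , F      = cd⇒Eventually t
          in na (truth⁻ A (⊆¹ A (here refl) m) z (F _ (inner s)))
        truth⁻ (A ▷ B) m y t = ¬¬-elim λ n →
          let U , c , (x , s , u , a) , avoid = Truthful.▷⁻ (M.truth l y) A B m n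
          in refuted avoid (e⇒Serves t (Inside l U) (inside-closed c)
               (λ k → just (l , x) , inner s , truth⁺ A (⊆¹ A (here refl) m) x a , inside u) [])
          where
          refuted : ∀ {U} → (∀ z → M.R l y z → U z → M.lab l z ∌ B) →
                    ¬ (Σ Pt λ z → Near [] (just (l , y)) z × T B z × Inside l U z)
          refuted avoid (_ , inner s , b , inside u) = avoid _ s u (truth⁻ B (⊆¹ B (right A B) m) _ b)

    listed : ∀ {k A} l → (∀ {B} → B ∈ A ∷ k → B ∈ l) → A ∈ sfs l
    listed l s = sfs-self l (s (here refl))

    mutual
      limit⁺ : ∀ A → Γ ∋ A → T A nothing
      limit⁺ (var n)  a = a
      limit⁺ ⊤'       a = tt
      limit⁺ ⊥'       a = ∋-⊥ a
      limit⁺ (¬' A)   na t = ∋-¬⁻ na (limit⁻ A t)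
      limit⁺ (A ∧' B) ab = limit⁺ A (∋-∧ˡ ab) , limit⁺ B (∋-∧ʳ ab)
      limit⁺ (A ∨' B) ab with ∋-∨⁻ ab
      ... | inj₁ a = inj₁ (limit⁺ A a)
      ... | inj₂ b = inj₂ (limit⁺ B b)
      limit⁺ (A ⇒ B)  ab t = limit⁺ B (∋-app ab (limit⁻ A t))
      limit⁺ (□ A)    a = Eventually⇒cd (A ∷ [] ,
        λ { _ (top {l} {y} s) → truth⁺ l A (listed l s) y (proj₁ (M.root-≺ l y A a)) })
      -- Shrinking the neighbourhood ensures that the frame met knows `A ▷ B`; the witness lies in
      -- the same frame, hence still in the neighbourhood `k`.
      limit⁺ (A ▷ B)  ab = Serves⇒e λ U c o k → served U c k (o ((A ▷ B) ∷ k))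
        where
        served : ∀ U → Closed Link U → ∀ k → (Σ Pt λ x → Near ((A ▷ B) ∷ k) nothing x × T A x × U x) →
                 Σ Pt λ z → Near k nothing z × T B z × U z
        served U c k (just (l , x) , top s , a , u) =
          let m = listed l s
              z , _ , Uz , b = Truthful.▷⁺ (M.truth₀ l) A B m ab (λ z → U (just (l , z)))
                (λ t → c (inner t)) x tt u (truth⁻ l A (⊆¹ l A (here refl) m) x a)
          in just (l , z) , top (λ x → s (there x)) , truth⁺ l B (⊆¹ l B (right l A B) m) z b , Uz

      limit⁻ : ∀ A → T A nothing → Γ ∋ A
      limit⁻ (var n)  t = t
      limit⁻ ⊤'       t = ∋-thm ⊤-intro
      limit⁻ (¬' A)   t = ∋-¬⁺ λ a → t (limit⁺ A a)
      limit⁻ (A ∧' B) (t , u) = ∋-∧⁺ (limit⁻ A t) (limit⁻ B u)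
      limit⁻ (A ∨' B) (inj₁ t) = ∋-∨ˡ (limit⁻ A t)
      limit⁻ (A ∨' B) (inj₂ t) = ∋-∨ʳ (limit⁻ B t)
      limit⁻ (A ⇒ B)  f = ∋-⇒⁺ λ a → limit⁻ B (f (limit⁺ A a))
      limit⁻ (□ A)    t = ¬¬-elim λ n →
        let k , F = cd⇒Eventually t
            l = □ A ∷ k
            m = sfs-self l (here refl)
            y , _ , na = Truthful.□⁻ (M.truth₀ l) A m n
        in na (truth⁻ l A (⊆¹ l A (here refl) m) y (F _ (top there)))
      limit⁻ (A ▷ B)  t = ¬¬-elim λ n → refuted n (e⇒Serves t (Refuting n) (refuting-closed n) (hits n) ((A ▷ B) ∷ []))
        where
        module _ (n : Γ ∌ A ▷ B) where
          Cone : ∀ l → (A ▷ B) ∈ sfs l → M.P l → Set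
          Cone l m = proj₁ (Truthful.▷⁻ (M.truth₀ l) A B m n)

          -- The refuting sets of all frames that know `A ▷ B`, united. Links never leave a frame,
          -- so the union is S-closed, and it meets every neighbourhood of the new point.
          data Refuting : Pt → Set where
            refuting : ∀ {l y} m → Cone l m y → Refuting (just (l , y))

          refuting-closed : Closed Link Refuting
          refuting-closed (inner {l} s) (refuting m u) =
            refuting m (proj₁ (proj₂ (Truthful.▷⁻ (M.truth₀ l) A B m n)) s u)

          hits : Often (λ z → T A z × Refuting z) nothing
          hits k =
            let l = (A ▷ B) ∷ k
                m = sfs-self l (here refl)
                _ , _ , (y , _ , u , a) , _ = Truthful.▷⁻ (M.truth₀ l) A B m n
            in just (l , y) , top there , truth⁺ l A (⊆¹ l A (here refl) m) y a , refuting m u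

          refuted : ¬ (Σ Pt λ z → Near ((A ▷ B) ∷ []) nothing z × T B z × Refuting z)
          refuted (_ , top {l} {y} s , b , refuting m u) =
            proj₂ (proj₂ (proj₂ (Truthful.▷⁻ (M.truth₀ l) A B m n))) y tt u
              (truth⁻ l B (⊆¹ l B (right l A B) m) y b)

  -- From models to strong completeness

  consequences : (Fm → Set) → Theory
  consequences Γ = record
    { has  = λ A → Γ ⊢[ L ] A
    ; thms = λ t → [] , [] , mp (weaken _ ⊤') t
    ; app  = λ (l , γ , f) (l′ , γ′ , a) → l ++ l′ , ++⁺ γ γ′ ,
        imp λ Δ c → ∋-app (∋-mp f (left l c)) (∋-mp a (right l c)) }
    where
    left : ∀ {Δ} l {l′} → Δ ∋ ⋀ (l ++ l′) → Δ ∋ ⋀ l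
    left []      c = ∋-thm ⊤-intro
    left (A ∷ l) c = ∋-∧⁺ (∋-∧ˡ c) (left l (∋-∧ʳ c))
    right : ∀ {Δ} l {l′} → Δ ∋ ⋀ (l ++ l′) → Δ ∋ ⋀ l′
    right []      c = c
    right (A ∷ l) c = right l (∋-∧ʳ c)

  strong-completeness :
    (∀ l Γ → Model (sfs l) Γ) → ∀ Γ φ → Γ ⊨[ L ] φ → Γ ⊢[ L ] φ
  strong-completeness models Γ φ ent = ¬¬-elim λ n →
    let Δ , inc , nφ = lindenbaum (consequences Γ) φ n
        open Limit Δ (λ l → models l Δ)
    in nφ (limit⁻ φ (ent space space-L V₀ nothing λ ψ γ →
         limit⁺ ψ (inc (ψ ∷ [] , γ ∷ [] , ∧-elimˡ ψ ⊤'))))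

theorem4p15 : Classical → (L : Logic) (Γ : Fm → Set) (φ : Fm) → Γ ⊨[ L ] φ → Γ ⊢[ L ] φ
theorem4p15 em CL = strong-completeness λ l →
  Weak.by-steps (sfs l) (Weak.step-CL (sfs l) (λ ()) (λ ()) (λ ()) (λ ()))
  where open Completeness em CL
theorem4p15 em CLM = strong-completeness λ l →
  Unravelling.unravelled (extra refl) (λ ()) (λ ()) (λ ()) (sfs l) (antecedent-closed l)
  where open Completeness em CLM
theorem4p15 em IL = strong-completeness λ l →
  Weak.by-steps (sfs l) (Weak.step-IL (sfs l) (extra refl) (λ ()) (λ ()) (λ ()))
  where open Completeness em IL
theorem4p15 em ILM = strong-completeness λ l →
  Unravelling.unravelled (extra (inj₂ refl)) (λ _ → extra (inj₁ refl)) (λ ()) (λ ()) (sfs l) (antecedent-closed l)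
  where open Completeness em ILM
theorem4p15 em ILP = strong-completeness λ l →
  Weak.by-steps (sfs l) (Weak.step-ILP (sfs l) (extra (inj₁ refl)) (extra (inj₂ refl)) (λ ()) (λ ()))
  where open Completeness em ILP
theorem4p15 em ILW = strong-completeness λ l →
  Weak.by-steps (sfs l) (Weak.step-ILW (sfs l) (extra (inj₁ refl)) (extra (inj₂ refl)) (λ ()) (λ ()))
  where open Completeness em ILW
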